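{- Let $L$ be a finite distributive lattice with rank function $r$, and let $\alpha,\beta,\gamma,\delta: L \to [0,\infty)$ satisfy \[ \alpha(x)\beta(y) \leq \gamma(x \vee y)\,\delta(x \wedge y) \quad \text{for all } x,y \in L. \] Then for all subsets $X,Y \subseteq L$, \[ \Big(\sum_{x \in X} \alpha(x)q^{r(x)}\Big)\Big( \sum_{x \in Y} \beta(x)q^{r(x)}\Big) \ll \Big(\sum_{x \in X \vee Y} \gamma(x)q^{r(x)}\Big)\Big( \sum_{x \in X \wedge Y} \delta(x)q^{r(x)}\Big), \] as polynomials in the indeterminate $q$.
   Context: For a finite lattice $L$ and $x \in L$, the rank $r(x)$ is the length (number of strict inequalities) of a longest chain in $L$ having $x$ as its maximal element; so the minimum element has rank $0$. For $X,Y \subseteq L$, $X \vee Y = \{x \vee y : x \in X, y \in Y\}$ and $X \wedge Y = \{x \wedge y : x \in X, y \in Y\}$. For real polynomials $P(q),R(q)$, $P(q) \ll R(q)$ means that every coefficient of $R(q)-P(q)$ is a non-negative real number. -}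

module Defs where

open import Data.Fin.Base using (Fin)
import Data.Fin.Properties as Fin
open import Data.List.Base using (List; []; _∷_; _++_; [_]; map; foldr; filter; replicate; tabulate)
open import Data.Nat.Base using (ℕ; zero; suc; _⊔_) renaming (_≤_ to _≤ⁿ_)
import Data.Nat.Properties as ℕ
open import Data.Product.Base using (Σ-syntax; ∃; ∃₂; _×_; _,_)
open import Data.Rational.Base
  using (ℚ; 0ℚ; 1ℚ; ½; _+_; _*_; _-_; -_; 1/_; ∣_∣; _≤_; _<_; Positive; NonZero; positive; nonNegative)
import Data.Rational.Properties as ℚ
open import Data.Rational.Solver using (module +-*-Solver)
open import Function.Base using (_∘_)
open import Function.Bundles using (Inverse; _↔_)
open import Level using (Level) renaming (suc to lsuc; _⊔_ to _⊔ˡ_)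
open import Relation.Binary.Core using (Rel)
open import Relation.Binary.Definitions using (DecidableEquality)
open import Relation.Binary.Lattice.Structures using (IsDistributiveLattice)
import Relation.Binary.Construct.NonStrictToStrict as NonStrictToStrict
open import Relation.Binary.PropositionalEquality
  using (_≡_; refl; sym; trans; cong; subst)
open import Relation.Nullary using (Dec)
open import Relation.Nullary.Decidable using (map′; _×-dec_)
open import Relation.Unary using (Pred; Decidable)

private
  variable
    p p′ : Level

IsCauchy : (ℕ → ℚ) → Set
IsCauchy x = ∀ ε → 0ℚ < ε →
  Σ[ N ∈ ℕ ] (∀ m n → N ≤ⁿ m → N ≤ⁿ n → ∣ x m - x n ∣ ≤ ε)

-- Two sequences with the same limit denote the same real; no quotient is taken,
-- so equality of reals is `x ≤ℝ y` together with `y ≤ℝ x`.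

record ℝ : Set where
  constructor mkℝ
  field
    seq    : ℕ → ℚ
    cauchy : IsCauchy seq

open ℝ public

infix  4 _≤ℝ_
infixl 6 _+ℝ_
infixl 7 _*ℝ_
infix  8 -ℝ_

-- The slack ε is what makes this the order on limits: a pointwise comparison
-- of the representatives would distinguish sequences with equal limits.

_≤ℝ_ : ℝ → ℝ → Set
x ≤ℝ y = ∀ ε → 0ℚ < ε → Σ[ N ∈ ℕ ] (∀ n → N ≤ⁿ n → seq x n ≤ seq y n + ε)

0ℝ : ℝ
0ℝ = mkℝ (λ _ → 0ℚ) (λ ε 0<ε → 0 , λ _ _ _ _ → ℚ.<⇒≤ 0<ε)

module CauchyLemmas where
  open +-*-Solver using (solve; _:+_; _:*_; _:-_; _:=_)

  *-pos : ∀ {a b} → 0ℚ < a → 0ℚ < b → 0ℚ < a * b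
  *-pos {a} {b} 0<a 0<b =
    ℚ.positive⁻¹ _ {{ℚ.pos*pos⇒pos a {{positive 0<a}} b {{positive 0<b}}}}

  halves : ∀ ε → ½ * ε + ½ * ε ≡ ε
  halves ε = trans (sym (ℚ.*-distribʳ-+ ε ½ ½)) (ℚ.*-identityˡ ε)

  ⊔ˡ : ∀ {N M m} → N ⊔ M ≤ⁿ m → N ≤ⁿ m
  ⊔ˡ {N} {M} = ℕ.≤-trans (ℕ.m≤m⊔n N M)

  ⊔ʳ : ∀ {N M m} → N ⊔ M ≤ⁿ m → M ≤ⁿ m
  ⊔ʳ {N} {M} = ℕ.≤-trans (ℕ.m≤n⊔m N M)

  +-cauchy : ∀ {x y} → IsCauchy x → IsCauchy y → IsCauchy (λ n → x n + y n)
  +-cauchy {x} {y} cx cy ε 0<ε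
    with cx (½ * ε) (*-pos (ℚ.positive⁻¹ ½) 0<ε) | cy (½ * ε) (*-pos (ℚ.positive⁻¹ ½) 0<ε)
  ... | N , hx | M , hy = N ⊔ M , λ m n N⊔M≤m N⊔M≤n → begin
    ∣ x m + y m - (x n + y n) ∣      ≡⟨ cong ∣_∣ (rearrange (x m) (y m) (x n) (y n)) ⟩
    ∣ (x m - x n) + (y m - y n) ∣    ≤⟨ ℚ.∣p+q∣≤∣p∣+∣q∣ (x m - x n) (y m - y n) ⟩
    ∣ x m - x n ∣ + ∣ y m - y n ∣    ≤⟨ ℚ.+-mono-≤ (hx m n (⊔ˡ N⊔M≤m) (⊔ˡ N⊔M≤n))
                                                   (hy m n (⊔ʳ {N} N⊔M≤m) (⊔ʳ {N} N⊔M≤n)) ⟩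
    ½ * ε + ½ * ε                    ≡⟨ halves ε ⟩
    ε                                ∎
    where
    open ℚ.≤-Reasoning
    rearrange : ∀ a b c d → a + b - (c + d) ≡ (a - c) + (b - d)
    rearrange = solve 4 (λ a b c d → a :+ b :- (c :+ d) := (a :- c) :+ (b :- d)) refl

  neg-cauchy : ∀ {x} → IsCauchy x → IsCauchy (λ n → - x n)
  neg-cauchy {x} cx ε 0<ε with cx ε 0<ε
  ... | N , h = N , λ m n N≤m N≤n → begin
    ∣ - x m - - x n ∣   ≡⟨ cong ∣_∣ (sym (ℚ.neg-distrib-+ (x m) (- x n))) ⟩
    ∣ - (x m - x n) ∣   ≡⟨ ℚ.∣-p∣≡∣p∣ (x m - x n) ⟩
    ∣ x m - x n ∣       ≤⟨ h m n N≤m N≤n ⟩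
    ε                   ∎
    where open ℚ.≤-Reasoning

  bound : ∀ {x} → IsCauchy x →
    Σ[ B ∈ ℚ ] 0ℚ < B × Σ[ N ∈ ℕ ] (∀ n → N ≤ⁿ n → ∣ x n ∣ ≤ B)
  bound {x} cx with cx 1ℚ (ℚ.positive⁻¹ 1ℚ)
  ... | N , h = 1ℚ + ∣ x N ∣
              , ℚ.+-mono-<-≤ (ℚ.positive⁻¹ 1ℚ) (ℚ.0≤∣p∣ (x N))
              , N
              , λ n N≤n → begin
    ∣ x n ∣                     ≡⟨ cong ∣_∣ (split (x n) (x N)) ⟩
    ∣ (x n - x N) + x N ∣       ≤⟨ ℚ.∣p+q∣≤∣p∣+∣q∣ (x n - x N) (x N) ⟩
    ∣ x n - x N ∣ + ∣ x N ∣     ≤⟨ ℚ.+-monoˡ-≤ ∣ x N ∣ (h n N N≤n ℕ.≤-refl) ⟩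
    1ℚ + ∣ x N ∣                ∎
    where
    open ℚ.≤-Reasoning
    split : ∀ a b → a ≡ (a - b) + b
    split = solve 2 (λ a b → a := (a :- b) :+ b) refl

  *-mono-∣∣ : ∀ {a b A B} → ∣ a ∣ ≤ A → ∣ b ∣ ≤ B → ∣ a * b ∣ ≤ A * B
  *-mono-∣∣ {a} {b} {A} {B} a≤A b≤B = begin
    ∣ a * b ∣       ≡⟨ ℚ.∣p*q∣≡∣p∣*∣q∣ a b ⟩
    ∣ a ∣ * ∣ b ∣   ≤⟨ ℚ.*-monoʳ-≤-nonNeg ∣ b ∣ {{ℚ.∣-∣-nonNeg b}} a≤A ⟩
    A * ∣ b ∣       ≤⟨ ℚ.*-monoˡ-≤-nonNeg A {{nonNegative (ℚ.≤-trans (ℚ.0≤∣p∣ a) a≤A)}} b≤B ⟩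
    A * B           ∎
    where open ℚ.≤-Reasoning

  *-difference : ∀ {a b c d A B δ} → ∣ a ∣ ≤ A → ∣ d ∣ ≤ B → ∣ a - c ∣ ≤ δ → ∣ b - d ∣ ≤ δ →
                 ∣ a * b - c * d ∣ ≤ A * δ + δ * B
  *-difference {a} {b} {c} {d} {A} {B} {δ} a≤A d≤B a-c≤δ b-d≤δ = begin
    ∣ a * b - c * d ∣                       ≡⟨ cong ∣_∣ (rearrange a b c d) ⟩
    ∣ a * (b - d) + (a - c) * d ∣           ≤⟨ ℚ.∣p+q∣≤∣p∣+∣q∣ (a * (b - d)) ((a - c) * d) ⟩
    ∣ a * (b - d) ∣ + ∣ (a - c) * d ∣       ≤⟨ ℚ.+-mono-≤ (*-mono-∣∣ {a} {b - d} a≤A b-d≤δ)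
                                                          (*-mono-∣∣ {a - c} {d} a-c≤δ d≤B) ⟩
    A * δ + δ * B                           ∎
    where
    open ℚ.≤-Reasoning
    rearrange : ∀ a b c d → a * b - c * d ≡ a * (b - d) + (a - c) * d
    rearrange = solve 4 (λ a b c d → a :* b :- c :* d := a :* (b :- d) :+ (a :- c) :* d) refl

  divide : ∀ C ε → 0ℚ < C → 0ℚ < ε → Σ[ δ ∈ ℚ ] 0ℚ < δ × δ * C ≡ ε
  divide C ε 0<C 0<ε =
      ε * 1/ C
    , *-pos 0<ε (ℚ.positive⁻¹ (1/ C) {{ℚ.1/pos⇒pos C}})
    , trans (ℚ.*-assoc ε (1/ C) C) (trans (cong (ε *_) (ℚ.*-inverseˡ C)) (ℚ.*-identityʳ ε))
    where
    instance
      C-pos : Positive C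
      C-pos = positive 0<C
      C-nonZero : NonZero C
      C-nonZero = ℚ.pos⇒nonZero C

  *-cauchy : ∀ {x y} → IsCauchy x → IsCauchy y → IsCauchy (λ n → x n * y n)
  *-cauchy {x} {y} cx cy ε 0<ε = combine (bound cx) (bound cy)
    where
    open ℚ.≤-Reasoning

    Conclusion : Set
    Conclusion = Σ[ N ∈ ℕ ] (∀ m n → N ≤ⁿ m → N ≤ⁿ n → ∣ x m * y m - x n * y n ∣ ≤ ε)

    combine′ : ∀ A B δ → δ * (A + B) ≡ ε →
      Σ[ N ∈ ℕ ] (∀ n → N ≤ⁿ n → ∣ x n ∣ ≤ A) →
      Σ[ N ∈ ℕ ] (∀ n → N ≤ⁿ n → ∣ y n ∣ ≤ B) →
      Σ[ N ∈ ℕ ] (∀ m n → N ≤ⁿ m → N ≤ⁿ n → ∣ x m - x n ∣ ≤ δ) →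
      Σ[ N ∈ ℕ ] (∀ m n → N ≤ⁿ m → N ≤ⁿ n → ∣ y m - y n ∣ ≤ δ) →
      Conclusion
    combine′ A B δ δ[A+B]≡ε (N₁ , hA) (N₂ , hB) (N₃ , hx) (N₄ , hy) =
      (N₁ ⊔ N₂) ⊔ (N₃ ⊔ N₄) , λ m n M≤m M≤n → begin
      ∣ x m * y m - x n * y n ∣
        ≤⟨ *-difference {x m} {y m} {x n} {y n}
             (hA m (⊔ˡ {N₁} {N₂} (⊔ˡ M≤m)))
             (hB n (⊔ʳ {N₁} {N₂} (⊔ˡ M≤n)))
             (hx m n (⊔ˡ {N₃} {N₄} (⊔ʳ {N₁ ⊔ N₂} M≤m)) (⊔ˡ {N₃} {N₄} (⊔ʳ {N₁ ⊔ N₂} M≤n)))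
             (hy m n (⊔ʳ {N₃} {N₄} (⊔ʳ {N₁ ⊔ N₂} M≤m)) (⊔ʳ {N₃} {N₄} (⊔ʳ {N₁ ⊔ N₂} M≤n))) ⟩
      A * δ + δ * B
        ≡⟨ cong (_+ δ * B) (ℚ.*-comm A δ) ⟩
      δ * A + δ * B
        ≡⟨ sym (ℚ.*-distribˡ-+ δ A B) ⟩
      δ * (A + B)
        ≡⟨ δ[A+B]≡ε ⟩
      ε ∎

    combine : Σ[ A ∈ ℚ ] 0ℚ < A × Σ[ N ∈ ℕ ] (∀ n → N ≤ⁿ n → ∣ x n ∣ ≤ A) →
              Σ[ B ∈ ℚ ] 0ℚ < B × Σ[ N ∈ ℕ ] (∀ n → N ≤ⁿ n → ∣ y n ∣ ≤ B) →
              Conclusion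
    combine (A , 0<A , hA) (B , 0<B , hB) =
      let δ , 0<δ , δ[A+B]≡ε = divide (A + B) ε (ℚ.+-mono-< 0<A 0<B) 0<ε
      in combine′ A B δ δ[A+B]≡ε hA hB (cx δ 0<δ) (cy δ 0<δ)

-- `abstract` because only the existence of these moduli matters.

abstract
  +-isCauchy : ∀ x y → IsCauchy (λ n → seq x n + seq y n)
  +-isCauchy x y = CauchyLemmas.+-cauchy {seq x} {seq y} (cauchy x) (cauchy y)

  neg-isCauchy : ∀ x → IsCauchy (λ n → - seq x n)
  neg-isCauchy x = CauchyLemmas.neg-cauchy {seq x} (cauchy x)

  *-isCauchy : ∀ x y → IsCauchy (λ n → seq x n * seq y n)
  *-isCauchy x y = CauchyLemmas.*-cauchy {seq x} {seq y} (cauchy x) (cauchy y)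

_+ℝ_ : ℝ → ℝ → ℝ
x +ℝ y = mkℝ (λ n → seq x n + seq y n) (+-isCauchy x y)

-ℝ_ : ℝ → ℝ
-ℝ x = mkℝ (λ n → - seq x n) (neg-isCauchy x)

_*ℝ_ : ℝ → ℝ → ℝ
x *ℝ y = mkℝ (λ n → seq x n * seq y n) (*-isCauchy x y)

-- a₀ ∷ a₁ ∷ … ∷ [] is a₀ + a₁ q + …; trailing zeros are allowed.

Poly : Set
Poly = List ℝ

coeff : Poly → ℕ → ℝ
coeff []      _       = 0ℝ
coeff (a ∷ P) zero    = a
coeff (a ∷ P) (suc k) = coeff P k

infixl 6 _+ₚ_ _-ₚ_
infixl 7 _*ₚ_
infix  4 _≪_

_+ₚ_ : Poly → Poly → Poly
[]      +ₚ R       = R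
(a ∷ P) +ₚ []      = a ∷ P
(a ∷ P) +ₚ (b ∷ R) = (a +ℝ b) ∷ (P +ₚ R)

_-ₚ_ : Poly → Poly → Poly
P -ₚ R = P +ₚ map -ℝ_ R

_*ₚ_ : Poly → Poly → Poly
[]      *ₚ R = []
(a ∷ P) *ₚ R = map (a *ℝ_) R +ₚ (0ℝ ∷ P *ₚ R)

infix 8 _·q^_

_·q^_ : ℝ → ℕ → Poly
a ·q^ k = replicate k 0ℝ ++ [ a ]

_≪_ : Poly → Poly → Set
P ≪ R = ∀ k → 0ℝ ≤ℝ coeff (R -ₚ P) k

record FiniteDistributiveLattice (c ℓ : Level) : Set (lsuc (c ⊔ˡ ℓ)) where
  infix  4 _≤ᴸ_
  infixr 6 _∨_
  infixr 7 _∧_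
  field
    Carrier               : Set c
    _≤ᴸ_                  : Rel Carrier ℓ
    _∨_                   : Carrier → Carrier → Carrier
    _∧_                   : Carrier → Carrier → Carrier
    isDistributiveLattice : IsDistributiveLattice _≡_ _≤ᴸ_ _∨_ _∧_
    size                  : ℕ
    enumeration           : Carrier ↔ Fin size

  open Inverse enumeration using (to; from; strictlyInverseʳ)

  open NonStrictToStrict _≡_ _≤ᴸ_ public using () renaming (_<_ to _<ᴸ_)

  -- Chains x₀ < x₁ < … < xₖ, indexed by the number k of strict inequalities
  -- and by the maximal element xₖ.

  data Chain : ℕ → Carrier → Set (c ⊔ˡ ℓ) where
    start : ∀ x → Chain 0 x
    _▹_   : ∀ {k x y} → Chain k x → x <ᴸ y → Chain (suc k) y

  IsRankFunction : (Carrier → ℕ) → Set (c ⊔ˡ ℓ)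
  IsRankFunction r = ∀ x → Chain (r x) x × (∀ k → Chain k x → k ≤ⁿ r x)

  _∨ˢ_ : Pred Carrier p → Pred Carrier p′ → Pred Carrier (c ⊔ˡ p ⊔ˡ p′)
  (X ∨ˢ Y) z = ∃₂ λ x y → X x × Y y × z ≡ x ∨ y

  _∧ˢ_ : Pred Carrier p → Pred Carrier p′ → Pred Carrier (c ⊔ˡ p ⊔ˡ p′)
  (X ∧ˢ Y) z = ∃₂ λ x y → X x × Y y × z ≡ x ∧ y

  _≟_ : DecidableEquality Carrier
  x ≟ y = map′
    (λ e → trans (sym (strictlyInverseʳ x)) (trans (cong from e) (strictlyInverseʳ y)))
    (cong to) (to x Fin.≟ to y)

  ∃? : {P : Pred Carrier p} → Decidable P → Dec (∃ P)
  ∃? {P = P} P? = map′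
    (λ (i , Pi) → from i , Pi)
    (λ (x , Px) → to x , subst P (sym (strictlyInverseʳ x)) Px)
    (Fin.any? (P? ∘ from))

  _∨ˢ?_ : {X : Pred Carrier p} {Y : Pred Carrier p′} →
          Decidable X → Decidable Y → Decidable (X ∨ˢ Y)
  (X? ∨ˢ? Y?) z = ∃? λ x → ∃? λ y → X? x ×-dec Y? y ×-dec (z ≟ (x ∨ y))

  _∧ˢ?_ : {X : Pred Carrier p} {Y : Pred Carrier p′} →
          Decidable X → Decidable Y → Decidable (X ∧ˢ Y)
  (X? ∧ˢ? Y?) z = ∃? λ x → ∃? λ y → X? x ×-dec Y? y ×-dec (z ≟ (x ∧ y))

  elements : List Carrier
  elements = tabulate from

  -- A subset is a decidable predicate, and Σₚ X? f is the sum of f x over the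
  -- x satisfying it, each counted once.

  Σₚ : {X : Pred Carrier p} → Decidable X → (Carrier → Poly) → Poly
  Σₚ X? f = foldr _+ₚ_ [] (map f (filter X? elements))

{-# OPTIONS --safe #-}
-- A longest chain c₀ < c₁ < … < cₘ from the minimum to the maximum of L consists of covers, and
-- x ↦ (whether cᵢ₊₁ ≤ x ∨ cᵢ)ᵢ embeds L as a sublattice of the m-cube in which r x is the number of ones.
-- Extending the functions by zero, it remains to compare, on the cube, the sums of α x β y and of
-- γ x δ y over the pairs with |x| + |y| = k.  Split these pairs according to the coordinates in which
-- x and y agree and their values there.  On each class the pairs are complementary in the remaining
-- coordinates, and the inequality between sums over complementary pairs follows from the classical
-- four functions theorem (see `complementary-pairs`).
--
-- Arithmetic takes place in ℚ, on the n-th approximants of the reals.  These satisfy the hypotheses only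
-- up to an error η, which is absorbed by replacing α, β by their positive parts and γ, δ by γ + 3η, δ + 3η.

module Submission where

open import Defs
open import Data.Bool.Base using (Bool; true; false; not) renaming (_∨_ to _∨ᵇ_; _∧_ to _∧ᵇ_)
import Data.Bool.Properties as Bool
open import Data.Fin.Base as Fin using (Fin)
open import Data.List.Base using (List; []; _∷_; _++_; map; foldr; filter)
open import Data.List.Membership.Propositional using (_∈_)
open import Data.List.Membership.Propositional.Properties using (∈-tabulate⁺; ∈-filter⁺; ∈-filter⁻)
open import Data.List.Relation.Unary.All as All using (All; []; _∷_)
open import Data.List.Relation.Unary.AllPairs using ([]; _∷_)
open import Data.List.Relation.Unary.Any using (here; there)
open import Data.List.Relation.Unary.Unique.Propositional using (Unique)
import Data.List.Relation.Unary.Unique.Propositional.Properties as Unique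
open import Data.Nat.Base as ℕ using (ℕ; zero; suc) renaming (_+_ to _+ⁿ_; _≤_ to _≤ⁿ_; _<_ to _<ⁿ_)
import Data.Nat.Properties as ℕ
open import Data.Product.Base using (Σ-syntax; _×_; _,_; proj₁; proj₂)
open import Data.Rational.Base as ℚ using (ℚ; 0ℚ; 1ℚ; _+_; _*_; _-_; -_; ∣_∣; _≤_; _<_; positive; nonNegative)
import Data.Rational.Properties as ℚ
open import Data.Rational.Solver using (module +-*-Solver)
open import Data.Sum.Base using (_⊎_; inj₁; inj₂)
open import Data.Unit.Base using (⊤; tt)
open import Data.Vec.Base as Vec using (Vec; []; _∷_)
import Data.Vec.Properties as Vec
open import Function.Base using (_∘_)
open import Function.Bundles using (Inverse)
open import Level using (Level; Lift; lift) renaming (_⊔_ to _⊔ˡ_)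
open import Relation.Binary.Lattice.Bundles using (DistributiveLattice)
open import Relation.Binary.Lattice.Structures using (IsDistributiveLattice)
import Relation.Binary.Lattice.Properties.DistributiveLattice as DistributiveLatticeProperties
import Relation.Binary.Lattice.Properties.JoinSemilattice as JoinSemilatticeProperties
import Relation.Binary.Lattice.Properties.Lattice as LatticeProperties
import Relation.Binary.Lattice.Properties.MeetSemilattice as MeetSemilatticeProperties
open import Relation.Binary.PropositionalEquality
  using (_≡_; _≢_; refl; sym; trans; cong; cong₂; subst; module ≡-Reasoning)
open import Relation.Nullary using (yes; no; does; contradiction)
open import Relation.Nullary.Decidable using (dec-true; dec-false)
open import Relation.Unary using (Pred; Decidable)

open +-*-Solver using (solve; _:+_; _:*_; _:-_; :-_; _:=_; con)

private
  variable
    a b : Level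
    A : Set a
    B : Set b

-- Order arithmetic of the rationals.

*-nonNeg : ∀ {p q} → 0ℚ ≤ p → 0ℚ ≤ q → 0ℚ ≤ p * q
*-nonNeg {p} {q} 0≤p 0≤q =
  ℚ.nonNegative⁻¹ _ {{ℚ.nonNeg*nonNeg⇒nonNeg p {{nonNegative 0≤p}} q {{nonNegative 0≤q}}}}

+-nonNeg : ∀ {p q} → 0ℚ ≤ p → 0ℚ ≤ q → 0ℚ ≤ p + q
+-nonNeg = ℚ.+-mono-≤

*-mono-≤-nonNeg : ∀ {p q s t} → 0ℚ ≤ q → 0ℚ ≤ s → p ≤ q → s ≤ t → p * s ≤ q * t
*-mono-≤-nonNeg {p} {q} {s} {t} 0≤q 0≤s p≤q s≤t = begin
  p * s   ≤⟨ ℚ.*-monoʳ-≤-nonNeg s {{nonNegative 0≤s}} p≤q ⟩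
  q * s   ≤⟨ ℚ.*-monoˡ-≤-nonNeg q {{nonNegative 0≤q}} s≤t ⟩
  q * t   ∎
  where open ℚ.≤-Reasoning

difference-nonNeg : ∀ {p q} → p ≤ q → 0ℚ ≤ q - p
difference-nonNeg {p} {q} p≤q = begin
  0ℚ      ≡⟨ ℚ.+-inverseʳ p ⟨
  p - p   ≤⟨ ℚ.+-monoˡ-≤ (- p) p≤q ⟩
  q - p   ∎
  where open ℚ.≤-Reasoning

≤-by-difference : ∀ {p q d} → q ≡ p + d → 0ℚ ≤ d → p ≤ q
≤-by-difference {p} {q} {d} q≡p+d 0≤d = begin
  p        ≡⟨ ℚ.+-identityʳ p ⟨
  p + 0ℚ   ≤⟨ ℚ.+-monoʳ-≤ p 0≤d ⟩
  p + d    ≡⟨ q≡p+d ⟨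
  q        ∎
  where open ℚ.≤-Reasoning

square-cancel-≤ : ∀ {p q} → 0ℚ ≤ q → p * p ≤ q * q → p ≤ q
square-cancel-≤ {p} {q} 0≤q p²≤q² with p ℚ.≤? q
... | yes p≤q = p≤q
... | no  p≰q = contradiction refl (ℚ.<⇒≢ (begin-strict
  q * q   ≤⟨ ℚ.*-monoˡ-≤-nonNeg q {{nonNegative 0≤q}} (ℚ.<⇒≤ q<p) ⟩
  q * p   <⟨ ℚ.*-monoˡ-<-pos p {{positive (ℚ.≤-<-trans 0≤q q<p)}} q<p ⟩
  p * p   ≤⟨ p²≤q² ⟩
  q * q   ∎))
  where
  open ℚ.≤-Reasoning
  q<p = ℚ.≰⇒> p≰q

-- Finite sums of rationals.

∑ : List A → (A → ℚ) → ℚ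
∑ []       f = 0ℚ
∑ (x ∷ xs) f = f x + ∑ xs f

∑-cong : ∀ (xs : List A) {f h : A → ℚ} → (∀ x → f x ≡ h x) → ∑ xs f ≡ ∑ xs h
∑-cong []       f≡h = refl
∑-cong (x ∷ xs) f≡h = cong₂ _+_ (f≡h x) (∑-cong xs f≡h)

∑-mono : ∀ (xs : List A) {f h : A → ℚ} → (∀ x → f x ≤ h x) → ∑ xs f ≤ ∑ xs h
∑-mono []       f≤h = ℚ.≤-refl
∑-mono (x ∷ xs) f≤h = ℚ.+-mono-≤ (f≤h x) (∑-mono xs f≤h)

∑-nonNeg : ∀ (xs : List A) {f : A → ℚ} → (∀ x → 0ℚ ≤ f x) → 0ℚ ≤ ∑ xs f
∑-nonNeg []       0≤f = ℚ.≤-refl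
∑-nonNeg (x ∷ xs) 0≤f = +-nonNeg (0≤f x) (∑-nonNeg xs 0≤f)

∑-+ : ∀ (xs : List A) (f h : A → ℚ) → ∑ xs (λ x → f x + h x) ≡ ∑ xs f + ∑ xs h
∑-+ []       f h = refl
∑-+ (x ∷ xs) f h = trans (cong (f x + h x +_) (∑-+ xs f h))
  (solve 4 (λ p q s t → p :+ q :+ (s :+ t) := p :+ s :+ (q :+ t)) refl (f x) (h x) (∑ xs f) (∑ xs h))

∑-*ˡ : ∀ (xs : List A) k (f : A → ℚ) → ∑ xs (λ x → k * f x) ≡ k * ∑ xs f
∑-*ˡ []       k f = sym (ℚ.*-zeroʳ k)
∑-*ˡ (x ∷ xs) k f = trans (cong (k * f x +_) (∑-*ˡ xs k f)) (sym (ℚ.*-distribˡ-+ k (f x) (∑ xs f)))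

∑-*ʳ : ∀ (xs : List A) k (f : A → ℚ) → ∑ xs (λ x → f x * k) ≡ ∑ xs f * k
∑-*ʳ xs k f = trans (∑-cong xs (λ x → ℚ.*-comm (f x) k)) (trans (∑-*ˡ xs k f) (ℚ.*-comm k (∑ xs f)))

∑-++ : ∀ (xs ys : List A) (f : A → ℚ) → ∑ (xs ++ ys) f ≡ ∑ xs f + ∑ ys f
∑-++ []       ys f = sym (ℚ.+-identityˡ _)
∑-++ (x ∷ xs) ys f = trans (cong (f x +_) (∑-++ xs ys f)) (sym (ℚ.+-assoc (f x) (∑ xs f) (∑ ys f)))

∑-map : ∀ (xs : List A) (e : A → B) (f : B → ℚ) → ∑ (map e xs) f ≡ ∑ xs (f ∘ e)
∑-map []       e f = refl
∑-map (x ∷ xs) e f = cong (f (e x) +_) (∑-map xs e f)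

-- The four functions theorem on the Boolean cube and its form for complementary pairs.

-- Bounding two terms a, b by their common bound m: m (m + m′) - m (a + b) ≥ (m - a)(m - b).
mixed-terms : ∀ {a b m m′} → 0ℚ ≤ m′ → a ≤ m → b ≤ m → a * b ≤ m * m′ → a + b ≤ m + m′
mixed-terms {a} {b} {m} {m′} 0≤m′ a≤m b≤m ab≤mm′ with 0ℚ ℚ.<? m
... | no  0≮m = ℚ.+-mono-≤ a≤m (ℚ.≤-trans b≤m (ℚ.≤-trans (ℚ.≮⇒≥ 0≮m) 0≤m′))
... | yes 0<m = ℚ.*-cancelˡ-≤-pos m {{positive 0<m}} (≤-by-difference
  (solve 4 (λ a b m m′ → m :* (m :+ m′)
              := m :* (a :+ b) :+ ((m :- a) :* (m :- b) :+ (m :* m′ :- a :* b))) refl a b m m′)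
  (+-nonNeg (*-nonNeg (difference-nonNeg a≤m) (difference-nonNeg b≤m)) (difference-nonNeg ab≤mm′)))

-- The case of the 1-cube. Products with equal indices are bounded term by term. Both mixed products
-- lie below `c₁ * d₀`, and their product lies below `(c₁ * d₀) * (c₀ * d₁)`, so `mixed-terms`
-- bounds their sum.
four-functions-two-points : ∀ {a₀ a₁ b₀ b₁ c₀ c₁ d₀ d₁} →
  0ℚ ≤ a₀ → 0ℚ ≤ a₁ → 0ℚ ≤ b₀ → 0ℚ ≤ b₁ → 0ℚ ≤ c₀ → 0ℚ ≤ c₁ → 0ℚ ≤ d₀ → 0ℚ ≤ d₁ →
  a₀ * b₀ ≤ c₀ * d₀ → a₀ * b₁ ≤ c₁ * d₀ → a₁ * b₀ ≤ c₁ * d₀ → a₁ * b₁ ≤ c₁ * d₁ →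
  (a₀ + a₁) * (b₀ + b₁) ≤ (c₀ + c₁) * (d₀ + d₁)
four-functions-two-points {a₀} {a₁} {b₀} {b₁} {c₀} {c₁} {d₀} {d₁} 0≤a₀ 0≤a₁ 0≤b₀ 0≤b₁ 0≤c₀ 0≤c₁ 0≤d₀ 0≤d₁
  h₀₀ h₀₁ h₁₀ h₁₁ = begin
  (a₀ + a₁) * (b₀ + b₁)                             ≡⟨ expand a₀ a₁ b₀ b₁ ⟩
  (a₀ * b₀ + a₁ * b₁) + (a₁ * b₀ + a₀ * b₁)         ≤⟨ ℚ.+-mono-≤ (ℚ.+-mono-≤ h₀₀ h₁₁)
                                                         (mixed-terms (*-nonNeg 0≤c₀ 0≤d₁) h₁₀ h₀₁ products) ⟩
  (c₀ * d₀ + c₁ * d₁) + (c₁ * d₀ + c₀ * d₁)         ≡⟨ expand c₀ c₁ d₀ d₁ ⟨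
  (c₀ + c₁) * (d₀ + d₁)                             ∎
  where
  open ℚ.≤-Reasoning
  expand : ∀ a b c d → (a + b) * (c + d) ≡ (a * c + b * d) + (b * c + a * d)
  expand = solve 4 (λ a b c d → (a :+ b) :* (c :+ d) := (a :* c :+ b :* d) :+ (b :* c :+ a :* d)) refl
  products : (a₁ * b₀) * (a₀ * b₁) ≤ (c₁ * d₀) * (c₀ * d₁)
  products = begin
    (a₁ * b₀) * (a₀ * b₁)   ≡⟨ solve 4 (λ a b c d → (a :* b) :* (c :* d) := (c :* b) :* (a :* d)) refl a₁ b₀ a₀ b₁ ⟩
    (a₀ * b₀) * (a₁ * b₁)   ≤⟨ *-mono-≤-nonNeg (*-nonNeg 0≤c₀ 0≤d₀) (*-nonNeg 0≤a₁ 0≤b₁) h₀₀ h₁₁ ⟩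
    (c₀ * d₀) * (c₁ * d₁)   ≡⟨ solve 4 (λ a b c d → (a :* b) :* (c :* d) := (c :* b) :* (a :* d)) refl c₀ d₀ c₁ d₁ ⟩
    (c₁ * d₀) * (c₀ * d₁)   ∎

Cube : ℕ → Set
Cube = Vec Bool

infixr 6 _⊔_
infixr 7 _⊓_

_⊔_ _⊓_ : ∀ {m} → Cube m → Cube m → Cube m
_⊔_ = Vec.zipWith _∨ᵇ_
_⊓_ = Vec.zipWith _∧ᵇ_

complement : ∀ {m} → Cube m → Cube m
complement = Vec.map not

weight : ∀ {m} → Cube m → ℕ
weight []          = 0
weight (false ∷ u) = weight u
weight (true  ∷ u) = suc (weight u)

cube : ∀ m → List (Cube m)
cube zero    = [] ∷ []
cube (suc m) = map (false ∷_) (cube m) ++ map (true ∷_) (cube m)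

∑-cube-suc : ∀ m (f : Cube (suc m) → ℚ) →
  ∑ (cube (suc m)) f ≡ ∑ (cube m) (f ∘ (false ∷_)) + ∑ (cube m) (f ∘ (true ∷_))
∑-cube-suc m f = trans (∑-++ (map (false ∷_) (cube m)) _ f)
  (cong₂ _+_ (∑-map (cube m) (false ∷_) f) (∑-map (cube m) (true ∷_) f))

∑-complement : ∀ m (f : Cube m → ℚ) → ∑ (cube m) (f ∘ complement) ≡ ∑ (cube m) f
∑-complement zero    f = refl
∑-complement (suc m) f = begin
  ∑ (cube (suc m)) (f ∘ complement)
    ≡⟨ ∑-cube-suc m (f ∘ complement) ⟩
  ∑ (cube m) (f ∘ (true ∷_) ∘ complement) + ∑ (cube m) (f ∘ (false ∷_) ∘ complement)
    ≡⟨ cong₂ _+_ (∑-complement m (f ∘ (true ∷_))) (∑-complement m (f ∘ (false ∷_))) ⟩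
  ∑ (cube m) (f ∘ (true ∷_)) + ∑ (cube m) (f ∘ (false ∷_))
    ≡⟨ ℚ.+-comm (∑ (cube m) (f ∘ (true ∷_))) _ ⟩
  ∑ (cube m) (f ∘ (false ∷_)) + ∑ (cube m) (f ∘ (true ∷_))
    ≡⟨ ∑-cube-suc m f ⟨
  ∑ (cube (suc m)) f ∎
  where open ≡-Reasoning

complement-involutive : ∀ {m} (u : Cube m) → complement (complement u) ≡ u
complement-involutive []      = refl
complement-involutive (b ∷ u) = cong₂ _∷_ (Bool.not-involutive b) (complement-involutive u)

complement-⊔ : ∀ {m} (u v : Cube m) → complement (u ⊔ v) ≡ complement u ⊓ complement v
complement-⊔ []          []      = refl
complement-⊔ (false ∷ u) (c ∷ v) = cong (not c ∷_) (complement-⊔ u v)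
complement-⊔ (true  ∷ u) (c ∷ v) = cong (false ∷_) (complement-⊔ u v)

complement-⊓ : ∀ {m} (u v : Cube m) → complement (u ⊓ v) ≡ complement u ⊔ complement v
complement-⊓ []          []      = refl
complement-⊓ (false ∷ u) (c ∷ v) = cong (true ∷_) (complement-⊓ u v)
complement-⊓ (true  ∷ u) (c ∷ v) = cong (not c ∷_) (complement-⊓ u v)

-- The Ahlswede-Daykin induction: summing each function over its first coordinate gives functions on
-- the m-cube, and the two-point case shows that these satisfy the hypothesis again.
four-functions : ∀ m {α β γ δ : Cube m → ℚ} →
  (∀ u → 0ℚ ≤ α u) → (∀ u → 0ℚ ≤ β u) → (∀ u → 0ℚ ≤ γ u) → (∀ u → 0ℚ ≤ δ u) →
  (∀ u v → α u * β v ≤ γ (u ⊔ v) * δ (u ⊓ v)) →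
  ∑ (cube m) α * ∑ (cube m) β ≤ ∑ (cube m) γ * ∑ (cube m) δ
four-functions zero {α} {β} {γ} {δ} 0≤α 0≤β 0≤γ 0≤δ h = begin
  (α [] + 0ℚ) * (β [] + 0ℚ)   ≡⟨ cong₂ _*_ (ℚ.+-identityʳ (α [])) (ℚ.+-identityʳ (β [])) ⟩
  α [] * β []                 ≤⟨ h [] [] ⟩
  γ [] * δ []                 ≡⟨ cong₂ _*_ (ℚ.+-identityʳ (γ [])) (ℚ.+-identityʳ (δ [])) ⟨
  (γ [] + 0ℚ) * (δ [] + 0ℚ)   ∎
  where open ℚ.≤-Reasoning
four-functions (suc m) {α} {β} {γ} {δ} 0≤α 0≤β 0≤γ 0≤δ h = begin
  ∑ (cube (suc m)) α * ∑ (cube (suc m)) β   ≡⟨ cong₂ _*_ (fibres α) (fibres β) ⟩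
  ∑ (cube m) (fibre α) * ∑ (cube m) (fibre β)
    ≤⟨ four-functions m (fibre-nonNeg 0≤α) (fibre-nonNeg 0≤β) (fibre-nonNeg 0≤γ) (fibre-nonNeg 0≤δ)
         (λ u v → four-functions-two-points (0≤α _) (0≤α _) (0≤β _) (0≤β _) (0≤γ _) (0≤γ _) (0≤δ _) (0≤δ _)
           (h (false ∷ u) (false ∷ v)) (h (false ∷ u) (true ∷ v))
           (h (true ∷ u) (false ∷ v)) (h (true ∷ u) (true ∷ v))) ⟩
  ∑ (cube m) (fibre γ) * ∑ (cube m) (fibre δ)   ≡⟨ cong₂ _*_ (fibres γ) (fibres δ) ⟨
  ∑ (cube (suc m)) γ * ∑ (cube (suc m)) δ   ∎
  where
  open ℚ.≤-Reasoning
  fibre : (Cube (suc m) → ℚ) → Cube m → ℚ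
  fibre f u = f (false ∷ u) + f (true ∷ u)
  fibres : ∀ f → ∑ (cube (suc m)) f ≡ ∑ (cube m) (fibre f)
  fibres f = trans (∑-cube-suc m f) (sym (∑-+ (cube m) (f ∘ (false ∷_)) (f ∘ (true ∷_))))
  fibre-nonNeg : ∀ {f} → (∀ u → 0ℚ ≤ f u) → ∀ u → 0ℚ ≤ fibre f u
  fibre-nonNeg 0≤f u = +-nonNeg (0≤f (false ∷ u)) (0≤f (true ∷ u))

-- The functions φ u = α u β uᶜ and ψ u = γ u δ uᶜ satisfy φ u φ vᶜ ≤ ψ (u ⊔ v) ψ (u ⊓ v)ᶜ,
-- so the four functions theorem bounds (∑ φ)² by (∑ ψ)².
complementary-pairs : ∀ m {α β γ δ : Cube m → ℚ} →
  (∀ u → 0ℚ ≤ α u) → (∀ u → 0ℚ ≤ β u) → (∀ u → 0ℚ ≤ γ u) → (∀ u → 0ℚ ≤ δ u) →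
  (∀ u v → α u * β v ≤ γ (u ⊔ v) * δ (u ⊓ v)) →
  ∑ (cube m) (λ u → α u * β (complement u)) ≤ ∑ (cube m) (λ u → γ u * δ (complement u))
complementary-pairs m {α} {β} {γ} {δ} 0≤α 0≤β 0≤γ 0≤δ h =
  square-cancel-≤ (∑-nonNeg (cube m) 0≤ψ) (begin
    ∑ (cube m) φ * ∑ (cube m) φ                  ≡⟨ cong (∑ (cube m) φ *_) (∑-complement m φ) ⟨
    ∑ (cube m) φ * ∑ (cube m) (φ ∘ complement)   ≤⟨ four-functions m 0≤φ (0≤φ ∘ complement) 0≤ψ (0≤ψ ∘ complement) step ⟩
    ∑ (cube m) ψ * ∑ (cube m) (ψ ∘ complement)   ≡⟨ cong (∑ (cube m) ψ *_) (∑-complement m ψ) ⟩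
    ∑ (cube m) ψ * ∑ (cube m) ψ                  ∎)
  where
  open ℚ.≤-Reasoning
  φ ψ : Cube m → ℚ
  φ u = α u * β (complement u)
  ψ u = γ u * δ (complement u)
  0≤φ : ∀ u → 0ℚ ≤ φ u
  0≤φ u = *-nonNeg (0≤α u) (0≤β (complement u))
  0≤ψ : ∀ u → 0ℚ ≤ ψ u
  0≤ψ u = *-nonNeg (0≤γ u) (0≤δ (complement u))
  swap-inner : ∀ p q s t → (p * q) * (s * t) ≡ (p * t) * (s * q)
  swap-inner = solve 4 (λ p q s t → (p :* q) :* (s :* t) := (p :* t) :* (s :* q)) refl
  step : ∀ u v → φ u * φ (complement v) ≤ ψ (u ⊔ v) * ψ (complement (u ⊓ v))
  step u v = begin
    (α u * β u′) * (α v′ * β (complement v′))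
      ≡⟨ cong (λ w → (α u * β u′) * (α v′ * β w)) (complement-involutive v) ⟩
    (α u * β u′) * (α v′ * β v)
      ≡⟨ swap-inner (α u) (β u′) (α v′) (β v) ⟩
    (α u * β v) * (α v′ * β u′)
      -- The hypothesis is used for `(u, v)` and for `(v′, u′)`. By De Morgan the second pair has as
      -- meet the complement of `u ⊔ v` and as join the complement of `u ⊓ v`, so the four factors
      -- regroup into two values of `ψ`.
      ≤⟨ *-mono-≤-nonNeg (*-nonNeg (0≤γ _) (0≤δ _)) (*-nonNeg (0≤α _) (0≤β _)) (h u v) (h v′ u′) ⟩
    (γ (u ⊔ v) * δ (u ⊓ v)) * (γ (v′ ⊔ u′) * δ (v′ ⊓ u′))
      ≡⟨ swap-inner (γ (u ⊔ v)) (δ (u ⊓ v)) (γ (v′ ⊔ u′)) (δ (v′ ⊓ u′)) ⟩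
    (γ (u ⊔ v) * δ (v′ ⊓ u′)) * (γ (v′ ⊔ u′) * δ (u ⊓ v))
      ≡⟨ cong₂ (λ s t → (γ (u ⊔ v) * δ s) * (γ t * δ (u ⊓ v))) meet join ⟩
    (γ (u ⊔ v) * δ (complement (u ⊔ v))) * (γ (complement (u ⊓ v)) * δ (u ⊓ v))
      ≡⟨ cong (λ w → ψ (u ⊔ v) * (γ (complement (u ⊓ v)) * δ w)) (complement-involutive (u ⊓ v)) ⟨
    ψ (u ⊔ v) * ψ (complement (u ⊓ v)) ∎
    where
    u′ = complement u
    v′ = complement v
    meet : v′ ⊓ u′ ≡ complement (u ⊔ v)
    meet = trans (Vec.zipWith-comm Bool.∧-comm v′ u′) (sym (complement-⊔ u v))
    join : v′ ⊔ u′ ≡ complement (u ⊓ v)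
    join = trans (Vec.zipWith-comm Bool.∨-comm v′ u′) (sym (complement-⊓ u v))

-- The four functions inequality on the cube, graded by total weight.

∑∑ : List A → List B → (A → B → ℚ) → ℚ
∑∑ xs ys F = ∑ xs (λ x → ∑ ys (F x))

∑∑-cong : ∀ (xs : List A) (ys : List B) {F G : A → B → ℚ} → (∀ x y → F x y ≡ G x y) → ∑∑ xs ys F ≡ ∑∑ xs ys G
∑∑-cong xs ys F≡G = ∑-cong xs (λ x → ∑-cong ys (F≡G x))

∑∑-mono : ∀ (xs : List A) (ys : List B) {F G : A → B → ℚ} → (∀ x y → F x y ≤ G x y) → ∑∑ xs ys F ≤ ∑∑ xs ys G
∑∑-mono xs ys F≤G = ∑-mono xs (λ x → ∑-mono ys (F≤G x))

∑∑-+ : ∀ (xs : List A) (ys : List B) (F G : A → B → ℚ) →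
  ∑∑ xs ys (λ x y → F x y + G x y) ≡ ∑∑ xs ys F + ∑∑ xs ys G
∑∑-+ xs ys F G = trans (∑-cong xs (λ x → ∑-+ ys (F x) (G x))) (∑-+ xs _ _)

∑∑-*ˡ : ∀ (xs : List A) (ys : List B) k (F : A → B → ℚ) → ∑∑ xs ys (λ x y → k * F x y) ≡ k * ∑∑ xs ys F
∑∑-*ˡ xs ys k F = trans (∑-cong xs (λ x → ∑-*ˡ ys k (F x))) (∑-*ˡ xs k _)

-- The pairs of vertices of the (m + 1)-cube, classified by their first coordinates: both 0, distinct, or both 1.
∑∑-cube-suc : ∀ m (g : ℕ → ℚ) (F : Cube (suc m) → Cube (suc m) → ℚ) →
  ∑∑ (cube (suc m)) (cube (suc m)) (λ x y → g (weight x +ⁿ weight y) * F x y) ≡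
    ∑∑ (cube m) (cube m) (λ x y → g (weight x +ⁿ weight y) * F (false ∷ x) (false ∷ y)) +
    (∑∑ (cube m) (cube m) (λ x y → g (suc (weight x +ⁿ weight y)) * (F (false ∷ x) (true ∷ y) + F (true ∷ x) (false ∷ y))) +
     ∑∑ (cube m) (cube m) (λ x y → g (suc (suc (weight x +ⁿ weight y))) * F (true ∷ x) (true ∷ y)))
∑∑-cube-suc m g F = begin
  ∑∑ (cube (suc m)) (cube (suc m)) G
    ≡⟨ ∑-cube-suc m _ ⟩
  ∑ (cube m) (λ x → ∑ (cube (suc m)) (G (false ∷ x))) + ∑ (cube m) (λ x → ∑ (cube (suc m)) (G (true ∷ x)))
    ≡⟨ cong₂ _+_ (row false) (row true) ⟩
  (S false false + S false true) + (S true false + S true true)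
    ≡⟨ solve 4 (λ p q s t → (p :+ q) :+ (s :+ t) := p :+ ((q :+ s) :+ t)) refl
         (S false false) (S false true) (S true false) (S true true) ⟩
  S false false + ((S false true + S true false) + S true true)
    ≡⟨ cong (S false false +_) (cong₂ _+_ mixed (∑∑-cong (cube m) (cube m) both)) ⟩
  _ ∎
  where
  open ≡-Reasoning
  G : Cube (suc m) → Cube (suc m) → ℚ
  G x y = g (weight x +ⁿ weight y) * F x y
  S : Bool → Bool → ℚ
  S b c = ∑∑ (cube m) (cube m) (λ x y → G (b ∷ x) (c ∷ y))
  row : ∀ b → ∑ (cube m) (λ x → ∑ (cube (suc m)) (G (b ∷ x))) ≡ S b false + S b true
  row b = trans (∑-cong (cube m) (λ x → ∑-cube-suc m (G (b ∷ x)))) (∑-+ (cube m) _ _)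
  both : ∀ x y → G (true ∷ x) (true ∷ y) ≡ g (suc (suc (weight x +ⁿ weight y))) * F (true ∷ x) (true ∷ y)
  both x y = cong (λ k → g (suc k) * F (true ∷ x) (true ∷ y)) (ℕ.+-suc (weight x) (weight y))
  mixed : S false true + S true false ≡
    ∑∑ (cube m) (cube m) (λ x y → g (suc (weight x +ⁿ weight y)) * (F (false ∷ x) (true ∷ y) + F (true ∷ x) (false ∷ y)))
  mixed = trans (sym (∑∑-+ (cube m) (cube m) _ _)) (∑∑-cong (cube m) (cube m) λ x y → begin
    g (weight x +ⁿ suc (weight y)) * F (false ∷ x) (true ∷ y) + g (suc (weight x +ⁿ weight y)) * F (true ∷ x) (false ∷ y)
      ≡⟨ cong (λ k → g k * F (false ∷ x) (true ∷ y) + g (suc (weight x +ⁿ weight y)) * F (true ∷ x) (false ∷ y))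
           (ℕ.+-suc (weight x) (weight y)) ⟩
    _ ≡⟨ ℚ.*-distribˡ-+ (g (suc (weight x +ⁿ weight y))) _ _ ⟨
    _ ∎)

-- The first argument of the functions records the coordinates in which the two vertices
-- are already known to differ; each induction step moves one coordinate there if it differs.
graded-four-functions′ : ∀ m d (g : ℕ → ℚ) → (∀ k → 0ℚ ≤ g k) → {α β γ δ : Cube d → Cube m → ℚ} →
  (∀ w x → 0ℚ ≤ α w x) → (∀ w x → 0ℚ ≤ β w x) → (∀ w x → 0ℚ ≤ γ w x) → (∀ w x → 0ℚ ≤ δ w x) →
  (∀ w w′ x y → α w x * β w′ y ≤ γ (w ⊔ w′) (x ⊔ y) * δ (w ⊓ w′) (x ⊓ y)) →
  ∑∑ (cube m) (cube m) (λ x y → g (weight x +ⁿ weight y) * ∑ (cube d) (λ w → α w x * β (complement w) y)) ≤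
  ∑∑ (cube m) (cube m) (λ x y → g (weight x +ⁿ weight y) * ∑ (cube d) (λ w → γ w x * δ (complement w) y))
graded-four-functions′ zero d g 0≤g 0≤α 0≤β 0≤γ 0≤δ h =
  -- All coordinates have been sorted, so a single class of complementary pairs remains, with
  -- constant factor `g 0`. The two `0ℚ` end the one-element sums over `cube 0`.
  ℚ.+-monoˡ-≤ 0ℚ (ℚ.+-monoˡ-≤ 0ℚ (ℚ.*-monoˡ-≤-nonNeg (g 0) {{nonNegative (0≤g 0)}}
    (complementary-pairs d (λ w → 0≤α w []) (λ w → 0≤β w []) (λ w → 0≤γ w []) (λ w → 0≤δ w [])
      (λ w w′ → h w w′ [] []))))
graded-four-functions′ (suc m) d g 0≤g {α} {β} {γ} {δ} 0≤α 0≤β 0≤γ 0≤δ h = begin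
  ∑∑ (cube (suc m)) (cube (suc m)) (λ x y → g (weight x +ⁿ weight y) * pairs α β x y)
    ≡⟨ split α β ⟩
  -- The first coordinates contribute 0, 1 or 2 to the total weight, and `g` is shifted accordingly;
  -- hence the induction is over all `g` at once.
  equal g false α β + (differ α β + equal (g ∘ suc ∘ suc) true α β)
    ≤⟨ ℚ.+-mono-≤ (equal-≤ g 0≤g false) (ℚ.+-mono-≤ differ-≤ (equal-≤ (g ∘ suc ∘ suc) (0≤g ∘ suc ∘ suc) true)) ⟩
  equal g false γ δ + (differ γ δ + equal (g ∘ suc ∘ suc) true γ δ)
    ≡⟨ split γ δ ⟨
  ∑∑ (cube (suc m)) (cube (suc m)) (λ x y → g (weight x +ⁿ weight y) * pairs γ δ x y) ∎
  where
  open ℚ.≤-Reasoning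
  Fun = Cube d → Cube (suc m) → ℚ

  pairs : Fun → Fun → Cube (suc m) → Cube (suc m) → ℚ
  pairs φ ψ x y = ∑ (cube d) (λ w → φ w x * ψ (complement w) y)

  equal : (ℕ → ℚ) → Bool → Fun → Fun → ℚ
  equal g b φ ψ = ∑∑ (cube m) (cube m) (λ x y → g (weight x +ⁿ weight y) * pairs φ ψ (b ∷ x) (b ∷ y))

  -- The differing coordinate passes from `x` to `w`. Complementing `w` gives the partner the
  -- opposite value, so the two mixed classes become one sum over the (d + 1)-cube.
  move : Fun → Cube (suc d) → Cube m → ℚ
  move φ (b ∷ w) x = φ w (b ∷ x)

  differ : Fun → Fun → ℚ
  differ φ ψ = ∑∑ (cube m) (cube m) (λ x y → g (suc (weight x +ⁿ weight y)) *
    ∑ (cube (suc d)) (λ w → move φ w x * move ψ (complement w) y))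

  split : ∀ φ ψ → ∑∑ (cube (suc m)) (cube (suc m)) (λ x y → g (weight x +ⁿ weight y) * pairs φ ψ x y) ≡
                  equal g false φ ψ + (differ φ ψ + equal (g ∘ suc ∘ suc) true φ ψ)
  split φ ψ = trans (∑∑-cube-suc m g (pairs φ ψ))
    (cong (λ s → equal g false φ ψ + (s + equal (g ∘ suc ∘ suc) true φ ψ))
      (∑∑-cong (cube m) (cube m) λ x y → cong (g (suc (weight x +ⁿ weight y)) *_)
        (sym (∑-cube-suc d (λ w → move φ w x * move ψ (complement w) y)))))

  equal-≤ : ∀ g → (∀ k → 0ℚ ≤ g k) → ∀ b → equal g b α β ≤ equal g b γ δ
  equal-≤ g 0≤g false = graded-four-functions′ m d g 0≤g (λ w _ → 0≤α w _) (λ w _ → 0≤β w _)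
    (λ w _ → 0≤γ w _) (λ w _ → 0≤δ w _) (λ w w′ x y → h w w′ (false ∷ x) (false ∷ y))
  equal-≤ g 0≤g true = graded-four-functions′ m d g 0≤g (λ w _ → 0≤α w _) (λ w _ → 0≤β w _)
    (λ w _ → 0≤γ w _) (λ w _ → 0≤δ w _) (λ w w′ x y → h w w′ (true ∷ x) (true ∷ y))

  move-nonNeg : ∀ {φ : Fun} → (∀ w x → 0ℚ ≤ φ w x) → ∀ w x → 0ℚ ≤ move φ w x
  move-nonNeg 0≤φ (b ∷ w) x = 0≤φ w (b ∷ x)

  differ-≤ : differ α β ≤ differ γ δ
  differ-≤ = graded-four-functions′ m (suc d) (g ∘ suc) (0≤g ∘ suc)
    (move-nonNeg 0≤α) (move-nonNeg 0≤β) (move-nonNeg 0≤γ) (move-nonNeg 0≤δ)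
    (λ { (b ∷ w) (c ∷ w′) x y → h w w′ (b ∷ x) (c ∷ y) })

-- With `g` the indicator of `k`, this compares coefficients of `q^k`. At the outset no coordinate
-- is known to differ, hence `d = 0`; each inner sum over `cube 0` is then one term followed by
-- `0ℚ`.
graded-four-functions : ∀ m (g : ℕ → ℚ) → (∀ k → 0ℚ ≤ g k) → {α β γ δ : Cube m → ℚ} →
  (∀ u → 0ℚ ≤ α u) → (∀ u → 0ℚ ≤ β u) → (∀ u → 0ℚ ≤ γ u) → (∀ u → 0ℚ ≤ δ u) →
  (∀ u v → α u * β v ≤ γ (u ⊔ v) * δ (u ⊓ v)) →
  ∑∑ (cube m) (cube m) (λ u v → g (weight u +ⁿ weight v) * (α u * β v)) ≤
  ∑∑ (cube m) (cube m) (λ u v → g (weight u +ⁿ weight v) * (γ u * δ v))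
graded-four-functions m g 0≤g {α} {β} {γ} {δ} 0≤α 0≤β 0≤γ 0≤δ h = begin
  ∑∑ (cube m) (cube m) (λ u v → g (weight u +ⁿ weight v) * (α u * β v))          ≡⟨ pad α β ⟨
  ∑∑ (cube m) (cube m) (λ u v → g (weight u +ⁿ weight v) * (α u * β v + 0ℚ))
    ≤⟨ graded-four-functions′ m 0 g 0≤g (λ _ → 0≤α) (λ _ → 0≤β) (λ _ → 0≤γ) (λ _ → 0≤δ) (λ _ _ → h) ⟩
  ∑∑ (cube m) (cube m) (λ u v → g (weight u +ⁿ weight v) * (γ u * δ v + 0ℚ))     ≡⟨ pad γ δ ⟩
  ∑∑ (cube m) (cube m) (λ u v → g (weight u +ⁿ weight v) * (γ u * δ v))          ∎
  where
  open ℚ.≤-Reasoning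
  pad : ∀ (φ ψ : Cube m → ℚ) → ∑∑ (cube m) (cube m) (λ u v → g (weight u +ⁿ weight v) * (φ u * ψ v + 0ℚ)) ≡
                               ∑∑ (cube m) (cube m) (λ u v → g (weight u +ⁿ weight v) * (φ u * ψ v))
  pad φ ψ = ∑∑-cong (cube m) (cube m) λ u v → cong (g (weight u +ⁿ weight v) *_) (ℚ.+-identityʳ (φ u * ψ v))

-- Embedding a finite distributive lattice in a cube, with rank as weight.

weight-mono-≤ : ∀ {m} (u v : Cube m) → u ⊓ v ≡ u → weight u ≤ⁿ weight v
weight-mono-≤ []          []          _ = ℕ.z≤n
weight-mono-≤ (false ∷ u) (false ∷ v) e = weight-mono-≤ u v (Vec.∷-injectiveʳ e)
weight-mono-≤ (false ∷ u) (true  ∷ v) e = ℕ.m≤n⇒m≤1+n (weight-mono-≤ u v (Vec.∷-injectiveʳ e))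
weight-mono-≤ (true  ∷ u) (true  ∷ v) e = ℕ.s≤s (weight-mono-≤ u v (Vec.∷-injectiveʳ e))

weight-mono-< : ∀ {m} (u v : Cube m) → u ⊓ v ≡ u → u ≢ v → weight u <ⁿ weight v
weight-mono-< []          []          _ u≢v = contradiction refl u≢v
weight-mono-< (false ∷ u) (false ∷ v) e u≢v =
  weight-mono-< u v (Vec.∷-injectiveʳ e) (λ u≡v → u≢v (cong (false ∷_) u≡v))
weight-mono-< (false ∷ u) (true  ∷ v) e u≢v = ℕ.s≤s (weight-mono-≤ u v (Vec.∷-injectiveʳ e))
weight-mono-< (true  ∷ u) (true  ∷ v) e u≢v =
  ℕ.s≤s (weight-mono-< u v (Vec.∷-injectiveʳ e) (λ u≡v → u≢v (cong (true ∷_) u≡v)))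

record CubeEmbedding {c ℓ} (L : FiniteDistributiveLattice c ℓ)
                     (r : FiniteDistributiveLattice.Carrier L → ℕ) : Set c where
  open FiniteDistributiveLattice L
  field
    dimension : ℕ
    χ         : Carrier → Cube dimension
    χ-∨       : ∀ x y → χ (x ∨ y) ≡ χ x ⊔ χ y
    χ-∧       : ∀ x y → χ (x ∧ y) ≡ χ x ⊓ χ y
    injective : ∀ {x y} → χ x ≡ χ y → x ≡ y
    weight-χ  : ∀ x → weight (χ x) ≡ r x

module _ {c ℓ} (L : FiniteDistributiveLattice c ℓ) where
  open FiniteDistributiveLattice L
  open IsDistributiveLattice isDistributiveLattice hiding (module Eq)
    renaming (refl to ≤-refl; trans to ≤-trans; reflexive to ≤-reflexive; antisym to ≤-antisym)

  private
    distributiveLattice : DistributiveLattice c c ℓ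
    distributiveLattice = record { isDistributiveLattice = isDistributiveLattice }
    open DistributiveLattice distributiveLattice using (lattice; joinSemilattice; meetSemilattice)
    open DistributiveLatticeProperties distributiveLattice using (∧-distribʳ-∨; ∨-distribʳ-∧)
    open JoinSemilatticeProperties joinSemilattice using (∨-comm; ∨-idempotent; ∨-monotonic; x≤y⇒x∨y≈y)
    open LatticeProperties lattice using (∧-absorbs-∨)
    open MeetSemilatticeProperties meetSemilattice using (∧-comm; ∧-idempotent; ∧-monotonic; y≤x⇒x∧y≈y)

  -- Absorption and distributivity turn `a` into `(a ∧ b) ∨ (a ∧ x)`, which the hypotheses make
  -- symmetric in `a` and `b`. Injectivity of the embedding rests on this.
  ∧-∨-cancel : ∀ {a b x} → a ∧ x ≡ b ∧ x → a ∨ x ≡ b ∨ x → a ≡ b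
  ∧-∨-cancel {a} {b} {x} a∧x≡b∧x a∨x≡b∨x = begin
    a                   ≡⟨ ∧-absorbs-∨ a x ⟨
    a ∧ (a ∨ x)         ≡⟨ cong (a ∧_) a∨x≡b∨x ⟩
    a ∧ (b ∨ x)         ≡⟨ ∧-distribˡ-∨ a b x ⟩
    (a ∧ b) ∨ (a ∧ x)   ≡⟨ cong₂ _∨_ (∧-comm a b) a∧x≡b∧x ⟩
    (b ∧ a) ∨ (b ∧ x)   ≡⟨ ∧-distribˡ-∨ b a x ⟨
    b ∧ (a ∨ x)         ≡⟨ cong (b ∧_) a∨x≡b∨x ⟩
    b ∧ (b ∨ x)         ≡⟨ ∧-absorbs-∨ b x ⟩
    b                   ∎
    where open ≡-Reasoning

  Covering : Carrier → Carrier → Set (c ⊔ˡ ℓ)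
  Covering x y = ∀ z → x ≤ᴸ z → z ≤ᴸ y → z ≡ x ⊎ z ≡ y

  -- For `x ≤ y` this is the retraction onto the interval from `x` to `y`, a lattice homomorphism by
  -- distributivity. If `y` covers `x`, the interval has two elements and the retraction amounts to
  -- a Boolean coordinate.
  clamp : Carrier → Carrier → Carrier → Carrier
  clamp x y z = (z ∧ y) ∨ x

  clamp-∨ : ∀ x y z w → clamp x y (z ∨ w) ≡ clamp x y z ∨ clamp x y w
  clamp-∨ x y z w = ≤-antisym
    (∨-least (subst (_≤ᴸ clamp x y z ∨ clamp x y w) (sym (∧-distribʳ-∨ y z w))
               (∨-monotonic (x≤x∨y (z ∧ y) x) (x≤x∨y (w ∧ y) x)))
             (≤-trans (y≤x∨y (z ∧ y) x) (x≤x∨y _ _)))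
    (∨-least (∨-monotonic (∧-monotonic (x≤x∨y z w) ≤-refl) ≤-refl)
             (∨-monotonic (∧-monotonic (y≤x∨y z w) ≤-refl) ≤-refl))

  clamp-∧ : ∀ x y z w → clamp x y (z ∧ w) ≡ clamp x y z ∧ clamp x y w
  clamp-∧ x y z w = ≤-antisym
    (∧-greatest (∨-monotonic (∧-monotonic (x∧y≤x z w) ≤-refl) ≤-refl)
                (∨-monotonic (∧-monotonic (x∧y≤y z w) ≤-refl) ≤-refl))
    (subst (_≤ᴸ clamp x y (z ∧ w)) (∨-distribʳ-∧ x (z ∧ y) (w ∧ y))
      (∨-monotonic (∧-greatest (∧-monotonic (x∧y≤x z y) (x∧y≤x w y)) (≤-trans (x∧y≤x _ _) (x∧y≤y z y))) ≤-refl))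

  -- For `x ≤ y`, distributivity gives `clamp x y z ≡ (z ∨ x) ∧ y`, so `true` means that `y` lies
  -- below `z ∨ x`.
  coordinate : Carrier → Carrier → Carrier → Bool
  coordinate x y z = does (clamp x y z ≟ y)

  data Clamped (x y z : Carrier) : Set c where
    lower : clamp x y z ≡ x → coordinate x y z ≡ false → Clamped x y z
    upper : clamp x y z ≡ y → coordinate x y z ≡ true  → Clamped x y z

  module _ {x y} (x<y : x <ᴸ y) (cover : Covering x y) where
    private
      x≤y : x ≤ᴸ y
      x≤y = proj₁ x<y
      x≢y : x ≢ y
      x≢y = proj₂ x<y

    coordinate-lower : ∀ {z} → clamp x y z ≡ x → coordinate x y z ≡ false
    coordinate-lower {z} e = dec-false (clamp x y z ≟ y) (λ e′ → x≢y (trans (sym e) e′))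

    coordinate-upper : ∀ {z} → clamp x y z ≡ y → coordinate x y z ≡ true
    coordinate-upper {z} = dec-true (clamp x y z ≟ y)

    clamped : ∀ z → Clamped x y z
    clamped z with cover (clamp x y z) (y≤x∨y (z ∧ y) x) (∨-least (x∧y≤y z y) x≤y)
    ... | inj₁ e = lower e (coordinate-lower e)
    ... | inj₂ e = upper e (coordinate-upper e)

    coordinate-∨ : ∀ z w → coordinate x y (z ∨ w) ≡ (coordinate x y z ∨ᵇ coordinate x y w)
    coordinate-∨ z w with clamped z | clamped w
    ... | lower p p′ | lower q q′ rewrite p′ | q′ =
      coordinate-lower (trans (clamp-∨ x y z w) (trans (cong₂ _∨_ p q) (∨-idempotent x)))
    ... | lower p p′ | upper q q′ rewrite p′ | q′ =
      coordinate-upper (trans (clamp-∨ x y z w) (trans (cong₂ _∨_ p q) (x≤y⇒x∨y≈y x≤y)))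
    ... | upper p p′ | lower q q′ rewrite p′ =
      coordinate-upper (trans (clamp-∨ x y z w) (trans (cong₂ _∨_ p q) (trans (∨-comm y x) (x≤y⇒x∨y≈y x≤y))))
    ... | upper p p′ | upper q q′ rewrite p′ =
      coordinate-upper (trans (clamp-∨ x y z w) (trans (cong₂ _∨_ p q) (∨-idempotent y)))

    coordinate-∧ : ∀ z w → coordinate x y (z ∧ w) ≡ (coordinate x y z ∧ᵇ coordinate x y w)
    coordinate-∧ z w with clamped z | clamped w
    ... | lower p p′ | lower q q′ rewrite p′ =
      coordinate-lower (trans (clamp-∧ x y z w) (trans (cong₂ _∧_ p q) (∧-idempotent x)))
    ... | lower p p′ | upper q q′ rewrite p′ =
      coordinate-lower (trans (clamp-∧ x y z w) (trans (cong₂ _∧_ p q) (trans (∧-comm x y) (y≤x⇒x∧y≈y x≤y))))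
    ... | upper p p′ | lower q q′ rewrite p′ | q′ =
      coordinate-lower (trans (clamp-∧ x y z w) (trans (cong₂ _∧_ p q) (y≤x⇒x∧y≈y x≤y)))
    ... | upper p p′ | upper q q′ rewrite p′ | q′ =
      coordinate-upper (trans (clamp-∧ x y z w) (trans (cong₂ _∧_ p q) (∧-idempotent y)))

    coordinate-injective : ∀ {z w} → coordinate x y z ≡ coordinate x y w → clamp x y z ≡ clamp x y w
    coordinate-injective {z} {w} e with clamped z | clamped w
    ... | lower p _  | lower q _  = trans p (sym q)
    ... | upper p _  | upper q _  = trans p (sym q)
    ... | lower _ p′ | upper _ q′ with () ← trans (sym p′) (trans e q′)
    ... | upper _ p′ | lower _ q′ with () ← trans (sym p′) (trans e q′)

    -- Here `z ∧ y` lies below `clamp x y z`, which is `x`. With `∧-step-upper`, this shows that the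
    -- meets of `z` with the chain move exactly at the coordinates that are `true`.
    ∧-step-lower : ∀ {z} → clamp x y z ≡ x → z ∧ x ≡ z ∧ y
    ∧-step-lower {z} e = ≤-antisym (∧-monotonic ≤-refl x≤y)
      (∧-greatest (x∧y≤x z y) (subst (z ∧ y ≤ᴸ_) e (x≤x∨y (z ∧ y) x)))

    ∧-step-upper : ∀ {z} → clamp x y z ≡ y → (z ∧ x) <ᴸ (z ∧ y)
    ∧-step-upper {z} e = ∧-monotonic ≤-refl x≤y , λ z∧x≡z∧y → x≢y (begin
      x             ≡⟨ x≤y⇒x∨y≈y (x∧y≤y z x) ⟨
      (z ∧ x) ∨ x   ≡⟨ cong (_∨ x) z∧x≡z∧y ⟩
      (z ∧ y) ∨ x   ≡⟨ e ⟩
      y             ∎)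
      where open ≡-Reasoning

    -- The element `z ∧ y` has meet `z ∧ x` and join `clamp x y z` with `x`, so cancellation
    -- recovers it from these two.
    meets-determine : ∀ {z w} → z ∧ x ≡ w ∧ x → clamp x y z ≡ clamp x y w → z ∧ y ≡ w ∧ y
    meets-determine {z} {w} z∧x≡w∧x = ∧-∨-cancel (trans (below z) (trans z∧x≡w∧x (sym (below w))))
      where
      below : ∀ z → (z ∧ y) ∧ x ≡ z ∧ x
      below z = ≤-antisym (∧-monotonic (x∧y≤x z y) ≤-refl)
        (∧-greatest (∧-monotonic ≤-refl x≤y) (x∧y≤y z x))

  Saturated : ∀ {k y} → Chain k y → Set (c ⊔ˡ ℓ)
  Saturated (start x)                  = Lift ℓ ⊤ × (∀ z → x ≤ᴸ z)
  Saturated (_▹_ {x = x} {y = y} C _)  = Saturated C × Covering x y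

  -- Any failure would lengthen the chain: by `z ∧ x` below its start, or by an element strictly
  -- inside a step. A prefix is again longest for its own endpoint, because a longer chain to that
  -- endpoint could be continued by the same last step.
  longest⇒saturated : ∀ {k y} (C : Chain k y) → (∀ j → Chain j y → j ≤ⁿ k) → Saturated C
  longest⇒saturated (start x) longest = lift tt , minimum
    where
    minimum : ∀ z → x ≤ᴸ z
    minimum z with (z ∧ x) ≟ x
    ... | yes e = subst (_≤ᴸ z) e (x∧y≤x z x)
    ... | no ¬e with () ← longest 1 (start (z ∧ x) ▹ (x∧y≤y z x , ¬e))
  longest⇒saturated (_▹_ {k = k} {x = x} {y = y} C x<y) longest =
    longest⇒saturated C (λ j D → ℕ.≤-pred (longest (suc j) (D ▹ x<y))) , cover
    where
    cover : Covering x y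
    cover z x≤z z≤y with z ≟ x | z ≟ y
    ... | yes e | _     = inj₁ e
    ... | no _  | yes e = inj₂ e
    ... | no ¬e | no ¬f = contradiction
      (longest (suc (suc k)) ((C ▹ (x≤z , λ e → ¬e (sym e))) ▹ (z≤y , ¬f))) (ℕ.1+n≰n)

  coordinates : ∀ {k y} → Chain k y → Carrier → Cube k
  coordinates (start _)                 z = []
  coordinates (_▹_ {x = x} {y = y} C _) z = coordinate x y z ∷ coordinates C z

  coordinates-∨ : ∀ {k y} (C : Chain k y) → Saturated C → ∀ z w →
    coordinates C (z ∨ w) ≡ coordinates C z ⊔ coordinates C w
  coordinates-∨ (start _) _           z w = refl
  coordinates-∨ (C ▹ x<y) (s , cover) z w = cong₂ _∷_ (coordinate-∨ x<y cover z w) (coordinates-∨ C s z w)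

  coordinates-∧ : ∀ {k y} (C : Chain k y) → Saturated C → ∀ z w →
    coordinates C (z ∧ w) ≡ coordinates C z ⊓ coordinates C w
  coordinates-∧ (start _) _           z w = refl
  coordinates-∧ (C ▹ x<y) (s , cover) z w = cong₂ _∷_ (coordinate-∧ x<y cover z w) (coordinates-∧ C s z w)

  -- Climbing the chain: at the minimum all meets agree, and each cover is crossed by
  -- `meets-determine`. When `y` is the greatest element the conclusion becomes `z ≡ w`.
  coordinates-injective : ∀ {k y} (C : Chain k y) → Saturated C → ∀ {z w} →
    coordinates C z ≡ coordinates C w → z ∧ y ≡ w ∧ y
  coordinates-injective (start x) (_ , minimum) _ = trans (y≤x⇒x∧y≈y (minimum _)) (sym (y≤x⇒x∧y≈y (minimum _)))
  coordinates-injective (C ▹ x<y) (s , cover) e =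
    meets-determine x<y cover (coordinates-injective C s (Vec.∷-injectiveʳ e))
      (coordinate-injective x<y cover (Vec.∷-injectiveˡ e))

  -- The strict steps among the elements z ∧ cᵢ, for (cᵢ) the given chain.
  restricted-chain : ∀ {k y} (C : Chain k y) → Saturated C → ∀ z → Chain (weight (coordinates C z)) (z ∧ y)
  restricted-chain (start x) _           z = start (z ∧ x)
  restricted-chain (C ▹ x<y) (s , cover) z with clamped x<y cover z
  ... | lower p p′ rewrite p′ = subst (Chain _) (∧-step-lower x<y cover p) (restricted-chain C s z)
  ... | upper p p′ rewrite p′ = restricted-chain C s z ▹ ∧-step-upper x<y cover p

  module _ {m} (χ : Carrier → Cube m) (χ-∧ : ∀ x y → χ (x ∧ y) ≡ χ x ⊓ χ y)
           (injective : ∀ {x y} → χ x ≡ χ y → x ≡ y) where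

    -- An injective map preserving meets is strictly monotone, so each strict step of a chain raises
    -- the weight by at least one.
    chain-length-≤-weight : ∀ {k x} → Chain k x → k ≤ⁿ weight (χ x)
    chain-length-≤-weight (start x) = ℕ.z≤n
    chain-length-≤-weight (_▹_ {x = x} {y = y} C (x≤y , x≢y)) = ℕ.≤-<-trans (chain-length-≤-weight C)
      (weight-mono-< (χ x) (χ y)
        (trans (sym (χ-∧ x y)) (cong χ (trans (∧-comm x y) (y≤x⇒x∧y≈y x≤y))))
        (λ e → x≢y (injective e)))

  greatest : Carrier → Carrier
  greatest x₀ = foldr _∨_ x₀ elements

  greatest-maximum : ∀ x₀ z → z ≤ᴸ greatest x₀
  greatest-maximum x₀ z =
    bound elements (subst (_∈ elements) (Inverse.strictlyInverseʳ enumeration z) (∈-tabulate⁺ (Inverse.to enumeration z)))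
    where
    bound : ∀ zs → z ∈ zs → z ≤ᴸ foldr _∨_ x₀ zs
    bound (_ ∷ zs) (here refl)  = x≤x∨y _ _
    bound (_ ∷ zs) (there z∈zs) = ≤-trans (bound zs z∈zs) (y≤x∨y _ _)

  cubeEmbedding : ∀ {r} → IsRankFunction r → CubeEmbedding L r
  cubeEmbedding {r} rank with ∃? {P = λ _ → ⊤} (λ _ → yes tt)
  -- An empty carrier is allowed and has no greatest element to end a chain at; the 0-cube serves
  -- vacuously.
  ... | no  empty    = record
    { dimension = 0
    ; χ         = λ _ → []
    ; χ-∨       = λ _ _ → refl
    ; χ-∧       = λ _ _ → refl
    ; injective = λ {x} → contradiction (x , tt) empty
    ; weight-χ  = λ x → contradiction (x , tt) empty
    }
  ... | yes (x₀ , _) = record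
    { dimension = r top
    ; χ         = coordinates C
    ; χ-∨       = coordinates-∨ C saturated
    ; χ-∧       = coordinates-∧ C saturated
    ; injective = injective
    -- The restricted chain ends at `x` and has as many steps as `x` has ones, so the weight is at
    -- most the rank. A longest chain ending at `x` gives the converse.
    ; weight-χ  = λ x → ℕ.≤-antisym
        (proj₂ (rank x) _ (subst (Chain _) (∧-top x) (restricted-chain C saturated x)))
        (chain-length-≤-weight (coordinates C) (coordinates-∧ C saturated) injective (proj₁ (rank x)))
    }
    where
    top : Carrier
    top = greatest x₀
    C : Chain (r top) top
    C = proj₁ (rank top)
    saturated : Saturated C
    saturated = longest⇒saturated C (proj₂ (rank top))
    ∧-top : ∀ x → x ∧ top ≡ x
    ∧-top x = trans (∧-comm x top) (y≤x⇒x∧y≈y (greatest-maximum x₀ x))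
    injective : ∀ {x y} → coordinates C x ≡ coordinates C y → x ≡ y
    injective {x} {y} e = trans (sym (∧-top x)) (trans (coordinates-injective C saturated e) (∧-top y))

-- Extending functions from the lattice to the cube by zero.

-- Recursion on both vertices lets this reduce along the splitting of the cube by first coordinate,
-- as `∑-kronecker` requires.
kronecker : ∀ {m} → Cube m → Cube m → ℚ
kronecker []          []          = 1ℚ
kronecker (false ∷ u) (false ∷ v) = kronecker u v
kronecker (false ∷ u) (true  ∷ v) = 0ℚ
kronecker (true  ∷ u) (false ∷ v) = 0ℚ
kronecker (true  ∷ u) (true  ∷ v) = kronecker u v

kronecker-nonNeg : ∀ {m} (u v : Cube m) → 0ℚ ≤ kronecker u v
kronecker-nonNeg []          []          = ℚ.<⇒≤ (ℚ.positive⁻¹ 1ℚ)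
kronecker-nonNeg (false ∷ u) (false ∷ v) = kronecker-nonNeg u v
kronecker-nonNeg (false ∷ u) (true  ∷ v) = ℚ.≤-refl
kronecker-nonNeg (true  ∷ u) (false ∷ v) = ℚ.≤-refl
kronecker-nonNeg (true  ∷ u) (true  ∷ v) = kronecker-nonNeg u v

kronecker-refl : ∀ {m} (u : Cube m) → kronecker u u ≡ 1ℚ
kronecker-refl []          = refl
kronecker-refl (false ∷ u) = kronecker-refl u
kronecker-refl (true  ∷ u) = kronecker-refl u

kronecker-≢ : ∀ {m} (u v : Cube m) → u ≢ v → kronecker u v ≡ 0ℚ
kronecker-≢ []          []          u≢v = contradiction refl u≢v
kronecker-≢ (false ∷ u) (false ∷ v) u≢v = kronecker-≢ u v (λ u≡v → u≢v (cong (false ∷_) u≡v))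
kronecker-≢ (false ∷ u) (true  ∷ v) u≢v = refl
kronecker-≢ (true  ∷ u) (false ∷ v) u≢v = refl
kronecker-≢ (true  ∷ u) (true  ∷ v) u≢v = kronecker-≢ u v (λ u≡v → u≢v (cong (true ∷_) u≡v))

∑-0* : ∀ {a} {A : Set a} (xs : List A) (h : A → ℚ) → ∑ xs (λ x → 0ℚ * h x) ≡ 0ℚ
∑-0* xs h = trans (∑-*ˡ xs 0ℚ h) (ℚ.*-zeroˡ (∑ xs h))

∑-kronecker : ∀ {m} (u : Cube m) (h : Cube m → ℚ) → ∑ (cube m) (λ v → kronecker u v * h v) ≡ h u
∑-kronecker []                  h = trans (ℚ.+-identityʳ _) (ℚ.*-identityˡ (h []))
∑-kronecker {suc m} (false ∷ u) h = trans (∑-cube-suc m (λ v → kronecker (false ∷ u) v * h v))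
  (trans (cong₂ _+_ (∑-kronecker u (λ v → h (false ∷ v))) (∑-0* (cube m) (λ v → h (true ∷ v))))
    (ℚ.+-identityʳ _))
∑-kronecker {suc m} (true  ∷ u) h = trans (∑-cube-suc m (λ v → kronecker (true ∷ u) v * h v))
  (trans (cong₂ _+_ (∑-0* (cube m) (λ v → h (false ∷ v))) (∑-kronecker u (λ v → h (true ∷ v))))
    (ℚ.+-identityˡ _))

module _ {a} {A : Set a} {m} (χ : A → Cube m) where

  -- The sum of `f` over the members of `xs` lying above `u`. For injective `χ` and `xs` without
  -- repetitions this is `f` restricted to `xs` and extended by zero.
  pushforward : List A → (A → ℚ) → Cube m → ℚ
  pushforward xs f u = ∑ xs (λ x → kronecker (χ x) u * f x)

  pushforward-nonNeg : ∀ xs {f} → (∀ x → 0ℚ ≤ f x) → ∀ u → 0ℚ ≤ pushforward xs f u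
  pushforward-nonNeg xs 0≤f u = ∑-nonNeg xs (λ x → *-nonNeg (kronecker-nonNeg (χ x) u) (0≤f x))

  ∑-pushforward : ∀ xs f (h : Cube m → ℚ) → ∑ (cube m) (λ u → pushforward xs f u * h u) ≡ ∑ xs (λ x → f x * h (χ x))
  ∑-pushforward []       f h = ∑-0* (cube m) h
  ∑-pushforward (x ∷ xs) f h = begin
    ∑ (cube m) (λ u → (kronecker (χ x) u * f x + pushforward xs f u) * h u)
      ≡⟨ ∑-cong (cube m) (λ u → solve 4 (λ k f p h → (k :* f :+ p) :* h := k :* (f :* h) :+ p :* h) refl
           (kronecker (χ x) u) (f x) (pushforward xs f u) (h u)) ⟩
    ∑ (cube m) (λ u → kronecker (χ x) u * (f x * h u) + pushforward xs f u * h u)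
      ≡⟨ ∑-+ (cube m) _ _ ⟩
    ∑ (cube m) (λ u → kronecker (χ x) u * (f x * h u)) + ∑ (cube m) (λ u → pushforward xs f u * h u)
      ≡⟨ cong₂ _+_ (∑-kronecker (χ x) (λ u → f x * h u)) (∑-pushforward xs f h) ⟩
    f x * h (χ x) + ∑ xs (λ x → f x * h (χ x)) ∎
    where open ≡-Reasoning

  ∑∑-pushforward : ∀ xs ys f h (G : Cube m → Cube m → ℚ) →
    ∑∑ (cube m) (cube m) (λ u v → G u v * (pushforward xs f u * pushforward ys h v)) ≡
    ∑∑ xs ys (λ x y → G (χ x) (χ y) * (f x * h y))
  ∑∑-pushforward xs ys f h G = begin
    ∑∑ (cube m) (cube m) (λ u v → G u v * (F u * H v))
      ≡⟨ ∑-cong (cube m) (λ u → trans (∑-cong (cube m) (λ v → rotate (G u v) (F u) (H v)))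
           (trans (∑-*ˡ (cube m) (F u) _) (cong (F u *_) (∑-pushforward ys h (G u))))) ⟩
    ∑ (cube m) (λ u → F u * ∑ ys (λ y → h y * G u (χ y)))
      ≡⟨ ∑-pushforward xs f (λ u → ∑ ys (λ y → h y * G u (χ y))) ⟩
    ∑ xs (λ x → f x * ∑ ys (λ y → h y * G (χ x) (χ y)))
      ≡⟨ ∑-cong xs (λ x → trans (sym (∑-*ˡ ys (f x) _))
           (∑-cong ys (λ y → sym (rotate (G (χ x) (χ y)) (f x) (h y))))) ⟩
    ∑∑ xs ys (λ x y → G (χ x) (χ y) * (f x * h y)) ∎
    where
    open ≡-Reasoning
    F = pushforward xs f
    H = pushforward ys h
    rotate : ∀ p q s → p * (q * s) ≡ q * (s * p)
    rotate = solve 3 (λ p q s → p :* (q :* s) := q :* (s :* p)) refl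

  pushforward-≥ : ∀ {xs f x} → (∀ y → 0ℚ ≤ f y) → x ∈ xs → f x ≤ pushforward xs f (χ x)
  pushforward-≥ {y ∷ xs} {f} {x} 0≤f (here refl) = ≤-by-difference
    (cong (_+ pushforward xs f (χ x)) (trans (cong (_* f x) (kronecker-refl (χ x))) (ℚ.*-identityˡ (f x))))
    (pushforward-nonNeg xs 0≤f (χ x))
  pushforward-≥ {y ∷ xs} {f} {x} 0≤f (there x∈xs) = ℚ.≤-trans (pushforward-≥ 0≤f x∈xs)
    (≤-by-difference (ℚ.+-comm _ (pushforward xs f (χ x))) (*-nonNeg (kronecker-nonNeg (χ y) (χ x)) (0≤f y)))

  pushforward-≢ : ∀ {xs} f {u} → All (λ x → χ x ≢ u) xs → pushforward xs f u ≡ 0ℚ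
  pushforward-≢ f []                         = refl
  pushforward-≢ f {u} (_∷_ {x = x} x≢u xs≢u) = cong₂ _+_
    (trans (cong (_* f x) (kronecker-≢ (χ x) u x≢u)) (ℚ.*-zeroˡ (f x))) (pushforward-≢ f xs≢u)

  -- Injectivity and the absence of repetitions leave at most one member of `xs` above `u`; every
  -- other term carries a vanishing Kronecker factor.
  pushforward-cases : (∀ {x y} → χ x ≡ χ y → x ≡ y) → ∀ {xs} → Unique xs → ∀ f u →
    pushforward xs f u ≡ 0ℚ ⊎ Σ[ x ∈ A ] x ∈ xs × χ x ≡ u × pushforward xs f u ≡ f x
  pushforward-cases injective [] f u = inj₁ refl
  pushforward-cases injective {x ∷ xs} (x∉xs ∷ unique) f u with Vec.≡-dec Bool._≟_ (χ x) u
  ... | yes refl = inj₂ (x , here refl , refl , (begin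
    kronecker (χ x) (χ x) * f x + pushforward xs f (χ x)
      ≡⟨ cong₂ _+_ (cong (_* f x) (kronecker-refl (χ x)))
           (pushforward-≢ f (All.map (λ x≢y χy≡χx → x≢y (injective (sym χy≡χx))) x∉xs)) ⟩
    1ℚ * f x + 0ℚ   ≡⟨ trans (ℚ.+-identityʳ _) (ℚ.*-identityˡ (f x)) ⟩
    f x             ∎))
    where open ≡-Reasoning
  ... | no χx≢u with skip ← trans (cong (_+ pushforward xs f u)
                       (trans (cong (_* f x) (kronecker-≢ (χ x) u χx≢u)) (ℚ.*-zeroˡ (f x)))) (ℚ.+-identityˡ _)
                   | pushforward-cases injective unique f u
  ...   | inj₁ p                    = inj₁ (trans skip p)
  ...   | inj₂ (y , y∈xs , χy , p)  = inj₂ (y , there y∈xs , χy , trans skip p)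

-- Inequalities up to an error η.

3ℚ : ℚ
3ℚ = 1ℚ + 1ℚ + 1ℚ

module _ {η} (0≤η : 0ℚ ≤ η) where
  private
    shifted-nonNeg : ∀ {p} → - η ≤ p → 0ℚ ≤ p + η
    shifted-nonNeg {p} -η≤p = subst (_≤ p + η) (ℚ.+-inverseˡ η) (ℚ.+-monoˡ-≤ η -η≤p)

    neg-nonNeg : ∀ {p} → p ≤ 0ℚ → 0ℚ ≤ - p
    neg-nonNeg = ℚ.neg-antimono-≤

    tripled-nonNeg : 0ℚ ≤ 3ℚ * η
    tripled-nonNeg = *-nonNeg (ℚ.<⇒≤ (ℚ.positive⁻¹ 3ℚ)) 0≤η

  raised-nonNeg : ∀ {p} → - η ≤ p → 0ℚ ≤ p + 3ℚ * η
  raised-nonNeg {p} -η≤p = subst (0ℚ ≤_)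
    (solve 2 (λ p η → p :+ η :+ (η :+ η) := p :+ con 3ℚ :* η) refl p η)
    (+-nonNeg (shifted-nonNeg -η≤p) (+-nonNeg 0≤η 0≤η))

  -- The error is incurred only when both factors are negative: they then lie between `- η` and 0,
  -- and their product is at most `η * η`. Factors of opposite sign have a product of at most 0.
  product-≤-positive-parts : ∀ {a b} → - η ≤ a → - η ≤ b → a * b ≤ (a ℚ.⊔ 0ℚ) * (b ℚ.⊔ 0ℚ) + η * η
  product-≤-positive-parts {a} {b} -η≤a -η≤b with ℚ.≤-total 0ℚ a | ℚ.≤-total 0ℚ b
  ... | inj₁ 0≤a | inj₁ 0≤b
    rewrite ℚ.p≥q⇒p⊔q≡p 0≤a | ℚ.p≥q⇒p⊔q≡p 0≤b = ≤-by-difference refl (*-nonNeg 0≤η 0≤η)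
  ... | inj₁ 0≤a | inj₂ b≤0
    rewrite ℚ.p≤q⇒p⊔q≡q b≤0 = ≤-by-difference
      (solve 3 (λ a a′ η → a′ :* con 0ℚ :+ η :* η := a :+ (η :* η :- a)) refl (a * b) (a ℚ.⊔ 0ℚ) η)
      (+-nonNeg (*-nonNeg 0≤η 0≤η) (subst (0ℚ ≤_) (sym (ℚ.neg-distribʳ-* a b)) (*-nonNeg 0≤a (neg-nonNeg b≤0))))
  ... | inj₂ a≤0 | inj₁ 0≤b
    rewrite ℚ.p≤q⇒p⊔q≡q a≤0 = ≤-by-difference
      (solve 3 (λ a b′ η → con 0ℚ :* b′ :+ η :* η := a :+ (η :* η :- a)) refl (a * b) (b ℚ.⊔ 0ℚ) η)
      (+-nonNeg (*-nonNeg 0≤η 0≤η) (subst (0ℚ ≤_) (sym (ℚ.neg-distribˡ-* a b)) (*-nonNeg (neg-nonNeg a≤0) 0≤b)))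
  ... | inj₂ a≤0 | inj₂ b≤0
    rewrite ℚ.p≤q⇒p⊔q≡q a≤0 = ≤-by-difference
      (solve 4 (λ a b b′ η → con 0ℚ :* b′ :+ η :* η := a :* b :+ (η :* (b :+ η) :+ (:- b) :* (a :+ η))) refl
         a b (b ℚ.⊔ 0ℚ) η)
      (+-nonNeg (*-nonNeg 0≤η (shifted-nonNeg -η≤b)) (*-nonNeg (neg-nonNeg b≤0) (shifted-nonNeg -η≤a)))

  -- If `a` or `b` is at most 0, the left side vanishes. Otherwise, raising `c` and `d` by `t * η`
  -- gains at least `(t² - 2t) * η²`, since `c + d` is at least `-2η`. This must cover `η * η`, and
  -- 3 is the least natural number `t` with `t² - 2t ≥ 1`.
  positive-parts-≤-raised : ∀ {a b c d} → - η ≤ c → - η ≤ d → a * b ≤ c * d + η * η →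
    (a ℚ.⊔ 0ℚ) * (b ℚ.⊔ 0ℚ) ≤ (c + 3ℚ * η) * (d + 3ℚ * η)
  positive-parts-≤-raised {a} {b} {c} {d} -η≤c -η≤d ab≤cd+η² with ℚ.≤-total 0ℚ a | ℚ.≤-total 0ℚ b
  ... | inj₂ a≤0 | _
    rewrite ℚ.p≤q⇒p⊔q≡q a≤0 | ℚ.*-zeroˡ (b ℚ.⊔ 0ℚ) = *-nonNeg (raised-nonNeg -η≤c) (raised-nonNeg -η≤d)
  ... | inj₁ _   | inj₂ b≤0
    rewrite ℚ.p≤q⇒p⊔q≡q b≤0 | ℚ.*-zeroʳ (a ℚ.⊔ 0ℚ) = *-nonNeg (raised-nonNeg -η≤c) (raised-nonNeg -η≤d)
  ... | inj₁ 0≤a | inj₁ 0≤b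
    rewrite ℚ.p≥q⇒p⊔q≡p 0≤a | ℚ.p≥q⇒p⊔q≡p 0≤b = ℚ.≤-trans ab≤cd+η² (≤-by-difference
      (solve 3 (λ c d η → (c :+ con 3ℚ :* η) :* (d :+ con 3ℚ :* η) :=
                 c :* d :+ η :* η :+ (con 3ℚ :* η :* ((c :+ η) :+ (d :+ η)) :+ (η :* η :+ η :* η))) refl c d η)
      (+-nonNeg (*-nonNeg tripled-nonNeg (+-nonNeg (shifted-nonNeg -η≤c) (shifted-nonNeg -η≤d)))
                (+-nonNeg (*-nonNeg 0≤η 0≤η) (*-nonNeg 0≤η 0≤η))))

  -- The assumption `η ≤ 1ℚ` turns the quadratic term into a linear one, so the cost of raising is
  -- `η` times a constant.
  raised-product-≤ : ∀ {c d C D} → η ≤ 1ℚ → c ≤ C → d ≤ D →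
    (c + 3ℚ * η) * (d + 3ℚ * η) ≤ c * d + η * (3ℚ * (C + D) + 3ℚ * 3ℚ)
  raised-product-≤ {c} {d} {C} {D} η≤1 c≤C d≤D = ≤-by-difference
    (solve 5 (λ c d C D η → c :* d :+ η :* (con 3ℚ :* (C :+ D) :+ con 3ℚ :* con 3ℚ) :=
       (c :+ con 3ℚ :* η) :* (d :+ con 3ℚ :* η) :+
       con 3ℚ :* η :* (((C :- c) :+ (D :- d)) :+ con 3ℚ :* (con 1ℚ :- η))) refl c d C D η)
    (*-nonNeg tripled-nonNeg (+-nonNeg (+-nonNeg (difference-nonNeg c≤C) (difference-nonNeg d≤D))
      (*-nonNeg (ℚ.<⇒≤ (ℚ.positive⁻¹ 3ℚ)) (difference-nonNeg η≤1))))

-- The graded inequality on the lattice, exact and approximate.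

module _ {a} {A : Set a} (g : ℕ → ℚ) (r : A → ℕ) where

  graded-sum : List A → List A → (A → A → ℚ) → ℚ
  graded-sum xs ys F = ∑∑ xs ys (λ x y → g (r x +ⁿ r y) * F x y)

  graded-sum-mono : (∀ k → 0ℚ ≤ g k) → ∀ xs ys {F G} → (∀ x y → F x y ≤ G x y) → graded-sum xs ys F ≤ graded-sum xs ys G
  graded-sum-mono 0≤g xs ys F≤G =
    ∑∑-mono xs ys (λ x y → ℚ.*-monoˡ-≤-nonNeg (g (r x +ⁿ r y)) {{nonNegative (0≤g _)}} (F≤G x y))

  graded-sum-+* : ∀ xs ys F k G →
    graded-sum xs ys (λ x y → F x y + k * G x y) ≡ graded-sum xs ys F + k * graded-sum xs ys G
  graded-sum-+* xs ys F k G = begin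
    graded-sum xs ys (λ x y → F x y + k * G x y)
      ≡⟨ ∑∑-cong xs ys (λ x y → solve 4 (λ g F k G → g :* (F :+ k :* G) := g :* F :+ k :* (g :* G)) refl
           (g (r x +ⁿ r y)) (F x y) k (G x y)) ⟩
    ∑∑ xs ys (λ x y → g (r x +ⁿ r y) * F x y + k * (g (r x +ⁿ r y) * G x y))
      ≡⟨ ∑∑-+ xs ys _ _ ⟩
    graded-sum xs ys F + ∑∑ xs ys (λ x y → k * (g (r x +ⁿ r y) * G x y))
      ≡⟨ cong (graded-sum xs ys F +_) (∑∑-*ˡ xs ys k _) ⟩
    graded-sum xs ys F + k * graded-sum xs ys G ∎
    where open ≡-Reasoning

  -- The factor of `η` in the total error: the first sum pays for passing to positive parts, the
  -- second for raising `γ` and `δ`. It is free of `η`, which can therefore be chosen afterwards.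
  defect : (xs ys zs ws : List A) (C D : A → ℚ) → ℚ
  defect xs ys zs ws C D = graded-sum xs ys (λ _ _ → 1ℚ) + graded-sum zs ws (λ z w → 3ℚ * (C z + D w) + 3ℚ * 3ℚ)

module _ {c ℓ} (L : FiniteDistributiveLattice c ℓ) {r : FiniteDistributiveLattice.Carrier L → ℕ}
         (embedding : CubeEmbedding L r) {g : ℕ → ℚ} (0≤g : ∀ k → 0ℚ ≤ g k) where
  open FiniteDistributiveLattice L
  open CubeEmbedding embedding

  module _ {xs ys zs ws : List Carrier} (xs! : Unique xs) (ys! : Unique ys)
           (joins : ∀ {x y} → x ∈ xs → y ∈ ys → (x ∨ y) ∈ zs)
           (meets : ∀ {x y} → x ∈ xs → y ∈ ys → (x ∧ y) ∈ ws) where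

    -- Extended by zero, the functions satisfy the hypothesis on the cube: either the left side
    -- vanishes, or `u` and `v` come from members of `xs` and `ys`, whose join and meet lie in `zs`
    -- and `ws` and are preserved by `χ`.
    lattice-four-functions : ∀ {α β γ δ : Carrier → ℚ} →
      (∀ x → 0ℚ ≤ α x) → (∀ x → 0ℚ ≤ β x) → (∀ x → 0ℚ ≤ γ x) → (∀ x → 0ℚ ≤ δ x) →
      (∀ x y → α x * β y ≤ γ (x ∨ y) * δ (x ∧ y)) →
      graded-sum g r xs ys (λ x y → α x * β y) ≤ graded-sum g r zs ws (λ x y → γ x * δ y)
    lattice-four-functions {α} {β} {γ} {δ} 0≤α 0≤β 0≤γ 0≤δ h = begin
      graded-sum g r xs ys (λ x y → α x * β y)
        ≡⟨ transport xs ys α β ⟨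
      ∑∑ (cube dimension) (cube dimension) (λ u v → g (weight u +ⁿ weight v) * (pushforward χ xs α u * pushforward χ ys β v))
        ≤⟨ graded-four-functions dimension g 0≤g
             (pushforward-nonNeg χ xs 0≤α) (pushforward-nonNeg χ ys 0≤β)
             (pushforward-nonNeg χ zs 0≤γ) (pushforward-nonNeg χ ws 0≤δ) hypothesis ⟩
      ∑∑ (cube dimension) (cube dimension) (λ u v → g (weight u +ⁿ weight v) * (pushforward χ zs γ u * pushforward χ ws δ v))
        ≡⟨ transport zs ws γ δ ⟩
      graded-sum g r zs ws (λ x y → γ x * δ y) ∎
      where
      open ℚ.≤-Reasoning
      transport : ∀ xs ys (f h : Carrier → ℚ) →
        ∑∑ (cube dimension) (cube dimension) (λ u v → g (weight u +ⁿ weight v) * (pushforward χ xs f u * pushforward χ ys h v)) ≡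
        graded-sum g r xs ys (λ x y → f x * h y)
      transport xs ys f h = trans (∑∑-pushforward χ xs ys f h (λ u v → g (weight u +ⁿ weight v)))
        (∑∑-cong xs ys (λ x y → cong (λ k → g k * (f x * h y)) (cong₂ _+ⁿ_ (weight-χ x) (weight-χ y))))
      target-nonNeg : ∀ u v → 0ℚ ≤ pushforward χ zs γ (u ⊔ v) * pushforward χ ws δ (u ⊓ v)
      target-nonNeg u v = *-nonNeg (pushforward-nonNeg χ zs 0≤γ (u ⊔ v)) (pushforward-nonNeg χ ws 0≤δ (u ⊓ v))
      hypothesis : ∀ u v → pushforward χ xs α u * pushforward χ ys β v ≤
                           pushforward χ zs γ (u ⊔ v) * pushforward χ ws δ (u ⊓ v)
      hypothesis u v with pushforward-cases χ injective xs! α u | pushforward-cases χ injective ys! β v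
      ... | inj₁ p | _ rewrite p | ℚ.*-zeroˡ (pushforward χ ys β v) = target-nonNeg u v
      ... | inj₂ _ | inj₁ q rewrite q | ℚ.*-zeroʳ (pushforward χ xs α u) = target-nonNeg u v
      ... | inj₂ (x , x∈xs , refl , p) | inj₂ (y , y∈ys , refl , q) = begin
        pushforward χ xs α (χ x) * pushforward χ ys β (χ y)
          ≡⟨ cong₂ _*_ p q ⟩
        α x * β y
          ≤⟨ h x y ⟩
        γ (x ∨ y) * δ (x ∧ y)
          ≤⟨ *-mono-≤-nonNeg (pushforward-nonNeg χ zs 0≤γ _) (0≤δ _)
               (pushforward-≥ χ 0≤γ (joins x∈xs y∈ys)) (pushforward-≥ χ 0≤δ (meets x∈xs y∈ys)) ⟩
        pushforward χ zs γ (χ (x ∨ y)) * pushforward χ ws δ (χ (x ∧ y))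
          ≡⟨ cong₂ (λ u v → pushforward χ zs γ u * pushforward χ ws δ v) (χ-∨ x y) (χ-∧ x y) ⟩
        pushforward χ zs γ (χ x ⊔ χ y) * pushforward χ ws δ (χ x ⊓ χ y) ∎

    approximate-four-functions : ∀ {α β γ δ C D : Carrier → ℚ} {η} → 0ℚ ≤ η → η ≤ 1ℚ →
      (∀ x → - η ≤ α x) → (∀ x → - η ≤ β x) → (∀ x → - η ≤ γ x) → (∀ x → - η ≤ δ x) →
      (∀ x → γ x ≤ C x) → (∀ x → δ x ≤ D x) →
      (∀ x y → α x * β y ≤ γ (x ∨ y) * δ (x ∧ y) + η * η) →
      graded-sum g r xs ys (λ x y → α x * β y) ≤ graded-sum g r zs ws (λ x y → γ x * δ y) + η * defect g r xs ys zs ws C D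
    approximate-four-functions {α} {β} {γ} {δ} {C} {D} {η} 0≤η η≤1 -η≤α -η≤β -η≤γ -η≤δ γ≤C δ≤D h = begin
      graded-sum g r xs ys (λ x y → α x * β y)
        -- The error `η * η` is weakened to `η * 1ℚ`, so that all errors add up to one multiple of
        -- `η`.
        ≤⟨ graded-sum-mono g r 0≤g xs ys (λ x y → ℚ.≤-trans (product-≤-positive-parts 0≤η (-η≤α x) (-η≤β y))
             (ℚ.+-monoʳ-≤ (α⁺ x * β⁺ y) (ℚ.*-monoˡ-≤-nonNeg η {{nonNegative 0≤η}} η≤1))) ⟩
      graded-sum g r xs ys (λ x y → α⁺ x * β⁺ y + η * 1ℚ)
        ≡⟨ graded-sum-+* g r xs ys (λ x y → α⁺ x * β⁺ y) η (λ _ _ → 1ℚ) ⟩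
      graded-sum g r xs ys (λ x y → α⁺ x * β⁺ y) + η * P
        ≤⟨ ℚ.+-monoˡ-≤ (η * P) (lattice-four-functions (λ x → ℚ.p≤q⊔p (α x) 0ℚ) (λ x → ℚ.p≤q⊔p (β x) 0ℚ)
             (λ x → raised-nonNeg 0≤η (-η≤γ x)) (λ x → raised-nonNeg 0≤η (-η≤δ x))
             (λ x y → positive-parts-≤-raised 0≤η {α x} {β y} (-η≤γ _) (-η≤δ _) (h x y))) ⟩
      graded-sum g r zs ws (λ z w → (γ z + 3ℚ * η) * (δ w + 3ℚ * η)) + η * P
        ≤⟨ ℚ.+-monoˡ-≤ (η * P) (graded-sum-mono g r 0≤g zs ws (λ z w → raised-product-≤ 0≤η η≤1 (γ≤C z) (δ≤D w))) ⟩
      graded-sum g r zs ws (λ z w → γ z * δ w + η * (3ℚ * (C z + D w) + 3ℚ * 3ℚ)) + η * P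
        ≡⟨ cong (_+ η * P) (graded-sum-+* g r zs ws (λ z w → γ z * δ w) η _) ⟩
      graded-sum g r zs ws (λ z w → γ z * δ w) + η * Q + η * P
        ≡⟨ solve 4 (λ s η p q → s :+ η :* q :+ η :* p := s :+ η :* (p :+ q)) refl
             (graded-sum g r zs ws (λ z w → γ z * δ w)) η P Q ⟩
      graded-sum g r zs ws (λ z w → γ z * δ w) + η * defect g r xs ys zs ws C D ∎
      where
      open ℚ.≤-Reasoning
      α⁺ β⁺ : Carrier → ℚ
      α⁺ x = α x ℚ.⊔ 0ℚ
      β⁺ y = β y ℚ.⊔ 0ℚ
      P = graded-sum g r xs ys (λ _ _ → 1ℚ)
      Q = graded-sum g r zs ws (λ z w → 3ℚ * (C z + D w) + 3ℚ * 3ℚ)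

-- Coefficients of products of polynomials.

-- The Cauchy product, with the recursion of `_*ₚ_`: constant term times the second factor, plus the
-- shifted rest.
convolution : (ℕ → ℚ) → (ℕ → ℚ) → ℕ → ℚ
convolution p s zero    = p 0 * s 0
convolution p s (suc k) = p 0 * s (suc k) + convolution (p ∘ suc) s k

convolution-cong : ∀ {p p′ s s′} → (∀ k → p k ≡ p′ k) → (∀ k → s k ≡ s′ k) →
  ∀ k → convolution p s k ≡ convolution p′ s′ k
convolution-cong p≡p′ s≡s′ zero    = cong₂ _*_ (p≡p′ 0) (s≡s′ 0)
convolution-cong p≡p′ s≡s′ (suc k) =
  cong₂ _+_ (cong₂ _*_ (p≡p′ 0) (s≡s′ (suc k))) (convolution-cong (p≡p′ ∘ suc) s≡s′ k)

module _ {a} {A : Set a} where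

  convolution-∑ˡ : ∀ (xs : List A) (p : A → ℕ → ℚ) s k →
    convolution (λ j → ∑ xs (λ x → p x j)) s k ≡ ∑ xs (λ x → convolution (p x) s k)
  convolution-∑ˡ xs p s zero    = sym (∑-*ʳ xs (s 0) (λ x → p x 0))
  convolution-∑ˡ xs p s (suc k) = trans
    (cong₂ _+_ (sym (∑-*ʳ xs (s (suc k)) (λ x → p x 0))) (convolution-∑ˡ xs (λ x → p x ∘ suc) s k))
    (sym (∑-+ xs _ _))

  convolution-∑ʳ : ∀ (ys : List A) p (s : A → ℕ → ℚ) k →
    convolution p (λ j → ∑ ys (λ y → s y j)) k ≡ ∑ ys (λ y → convolution p (s y) k)
  convolution-∑ʳ ys p s zero    = sym (∑-*ˡ ys (p 0) (λ y → s y 0))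
  convolution-∑ʳ ys p s (suc k) = trans
    (cong₂ _+_ (sym (∑-*ˡ ys (p 0) (λ y → s y (suc k)))) (convolution-∑ʳ ys (p ∘ suc) s k))
    (sym (∑-+ ys _ _))

convolution-zeroˡ : ∀ s k → convolution (λ _ → 0ℚ) s k ≡ 0ℚ
convolution-zeroˡ s zero    = ℚ.*-zeroˡ (s 0)
convolution-zeroˡ s (suc k) = cong₂ _+_ (ℚ.*-zeroˡ (s (suc k))) (convolution-zeroˡ s k)

-- The coefficient of `q^k` in `a q^j`. For `a = 1ℚ` this is the indicator of `j ≡ k`, which later
-- serves as `g`.
monomial : ℚ → ℕ → ℕ → ℚ
monomial a zero    zero    = a
monomial a zero    (suc k) = 0ℚ
monomial a (suc j) zero    = 0ℚ
monomial a (suc j) (suc k) = monomial a j k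

monomial-scale : ∀ a b j k → a * monomial b j k ≡ monomial 1ℚ j k * (a * b)
monomial-scale a b zero    zero    = sym (ℚ.*-identityˡ (a * b))
monomial-scale a b zero    (suc k) = trans (ℚ.*-zeroʳ a) (sym (ℚ.*-zeroˡ (a * b)))
monomial-scale a b (suc j) zero    = trans (ℚ.*-zeroʳ a) (sym (ℚ.*-zeroˡ (a * b)))
monomial-scale a b (suc j) (suc k) = monomial-scale a b j k

monomial-nonNeg : ∀ j k → 0ℚ ≤ monomial 1ℚ j k
monomial-nonNeg zero    zero    = ℚ.<⇒≤ (ℚ.positive⁻¹ 1ℚ)
monomial-nonNeg zero    (suc k) = ℚ.≤-refl
monomial-nonNeg (suc j) zero    = ℚ.≤-refl
monomial-nonNeg (suc j) (suc k) = monomial-nonNeg j k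

convolution-monomials : ∀ a i b j k →
  convolution (monomial a i) (monomial b j) k ≡ monomial 1ℚ (i +ⁿ j) k * (a * b)
convolution-monomials a zero    b j zero    = monomial-scale a b j 0
convolution-monomials a zero    b j (suc k) = trans
  (cong (a * monomial b j (suc k) +_) (convolution-zeroˡ (monomial b j) k))
  (trans (ℚ.+-identityʳ _) (monomial-scale a b j (suc k)))
convolution-monomials a (suc i) b j zero    = trans (ℚ.*-zeroˡ (monomial b j 0)) (sym (ℚ.*-zeroˡ (a * b)))
convolution-monomials a (suc i) b j (suc k) = trans
  (cong (_+ convolution (monomial a i) (monomial b j) k) (ℚ.*-zeroˡ (monomial b j (suc k))))
  (trans (ℚ.+-identityˡ _) (convolution-monomials a i b j k))

module _ (n : ℕ) where

  -- Arithmetic of reals is termwise on the representing sequences, so taking n-th terms commutes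
  -- exactly with the polynomial operations.
  approximant : Poly → ℕ → ℚ
  approximant P k = seq (coeff P k) n

  approximant-+ : ∀ P R k → approximant (P +ₚ R) k ≡ approximant P k + approximant R k
  approximant-+ []      R       k       = sym (ℚ.+-identityˡ _)
  approximant-+ (a ∷ P) []      k       = sym (ℚ.+-identityʳ _)
  approximant-+ (a ∷ P) (b ∷ R) zero    = refl
  approximant-+ (a ∷ P) (b ∷ R) (suc k) = approximant-+ P R k

  approximant-neg : ∀ P k → approximant (map -ℝ_ P) k ≡ - approximant P k
  approximant-neg []      k       = refl
  approximant-neg (a ∷ P) zero    = refl
  approximant-neg (a ∷ P) (suc k) = approximant-neg P k

  approximant-- : ∀ R P k → approximant (R -ₚ P) k ≡ approximant R k - approximant P k
  approximant-- R P k = trans (approximant-+ R (map -ℝ_ P) k) (cong (approximant R k +_) (approximant-neg P k))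

  approximant-scale : ∀ a P k → approximant (map (a *ℝ_) P) k ≡ seq a n * approximant P k
  approximant-scale a []      k       = sym (ℚ.*-zeroʳ (seq a n))
  approximant-scale a (b ∷ P) zero    = refl
  approximant-scale a (b ∷ P) (suc k) = approximant-scale a P k

  approximant-* : ∀ P R k → approximant (P *ₚ R) k ≡ convolution (approximant P) (approximant R) k
  approximant-* []      R k       = sym (convolution-zeroˡ (approximant R) k)
  approximant-* (a ∷ P) R zero    = trans (approximant-+ (map (a *ℝ_) R) (0ℝ ∷ P *ₚ R) 0)
    (trans (ℚ.+-identityʳ _) (approximant-scale a R 0))
  approximant-* (a ∷ P) R (suc k) = trans (approximant-+ (map (a *ℝ_) R) (0ℝ ∷ P *ₚ R) (suc k))
    (cong₂ _+_ (approximant-scale a R (suc k)) (approximant-* P R k))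

  approximant-monomial : ∀ a j k → approximant (a ·q^ j) k ≡ monomial (seq a n) j k
  approximant-monomial a zero    zero    = refl
  approximant-monomial a zero    (suc k) = refl
  approximant-monomial a (suc j) zero    = refl
  approximant-monomial a (suc j) (suc k) = approximant-monomial a j k

  approximant-∑ : ∀ {a} {A : Set a} (xs : List A) (α : A → ℝ) (r : A → ℕ) k →
    approximant (foldr _+ₚ_ [] (map (λ x → α x ·q^ r x) xs)) k ≡ ∑ xs (λ x → monomial (seq (α x) n) (r x) k)
  approximant-∑ []       α r k = refl
  approximant-∑ (x ∷ xs) α r k = trans (approximant-+ (α x ·q^ r x) _ k)
    (cong₂ _+_ (approximant-monomial (α x) (r x) k) (approximant-∑ xs α r k))

  -- Expanding the Cauchy product bilinearly into monomials brings the coefficient of `q^k` into the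
  -- form of a `graded-sum`.
  approximant-product : ∀ {a} {A : Set a} (xs ys : List A) (α β : A → ℝ) (r : A → ℕ) k →
    approximant (foldr _+ₚ_ [] (map (λ x → α x ·q^ r x) xs) *ₚ foldr _+ₚ_ [] (map (λ x → β x ·q^ r x) ys)) k ≡
    ∑∑ xs ys (λ x y → monomial 1ℚ (r x +ⁿ r y) k * (seq (α x) n * seq (β y) n))
  approximant-product xs ys α β r k = begin
    approximant (foldr _+ₚ_ [] (map (λ x → α x ·q^ r x) xs) *ₚ foldr _+ₚ_ [] (map (λ x → β x ·q^ r x) ys)) k
      ≡⟨ approximant-* (foldr _+ₚ_ [] (map (λ x → α x ·q^ r x) xs)) _ k ⟩
    _ ≡⟨ convolution-cong (approximant-∑ xs α r) (approximant-∑ ys β r) k ⟩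
    convolution (λ j → ∑ xs (λ x → monomial (seq (α x) n) (r x) j)) (λ j → ∑ ys (λ y → monomial (seq (β y) n) (r y) j)) k
      ≡⟨ convolution-∑ˡ xs _ _ k ⟩
    ∑ xs (λ x → convolution (monomial (seq (α x) n) (r x)) (λ j → ∑ ys (λ y → monomial (seq (β y) n) (r y) j)) k)
      ≡⟨ ∑-cong xs (λ x → convolution-∑ʳ ys _ _ k) ⟩
    ∑∑ xs ys (λ x y → convolution (monomial (seq (α x) n) (r x)) (monomial (seq (β y) n) (r y)) k)
      ≡⟨ ∑∑-cong xs ys (λ x y → convolution-monomials _ (r x) _ (r y) k) ⟩
    ∑∑ xs ys (λ x y → monomial 1ℚ (r x +ⁿ r y) k * (seq (α x) n * seq (β y) n)) ∎
    where open ≡-Reasoning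

-- Eventual properties of sequences, and the choice of η.

-- `x ≤ℝ y` is by definition an `Eventually` statement for every positive slack, so hypotheses and
-- conclusion about reals can be combined at a common index `n`.
Eventually : ∀ {p} → (ℕ → Set p) → Set p
Eventually P = Σ[ N ∈ ℕ ] (∀ n → N ≤ⁿ n → P n)

eventually-× : ∀ {p q} {P : ℕ → Set p} {Q : ℕ → Set q} →
  Eventually P → Eventually Q → Eventually (λ n → P n × Q n)
eventually-× (N , hP) (M , hQ) =
  N ℕ.⊔ M , λ n le → hP n (ℕ.m⊔n≤o⇒m≤o N M le) , hQ n (ℕ.m⊔n≤o⇒n≤o N M le)

eventually-map : ∀ {p q} {P : ℕ → Set p} {Q : ℕ → Set q} →
  (∀ n → P n → Q n) → Eventually P → Eventually Q
eventually-map f (N , h) = N , λ n le → f n (h n le)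

eventually-Fin : ∀ {p} m {P : Fin m → ℕ → Set p} →
  (∀ i → Eventually (P i)) → Eventually (λ n → ∀ i → P i n)
eventually-Fin zero    h = 0 , λ _ _ ()
eventually-Fin (suc m) h = eventually-map (λ { n (h₀ , hₛ) Fin.zero → h₀ ; n (h₀ , hₛ) (Fin.suc i) → hₛ i })
  (eventually-× (h Fin.zero) (eventually-Fin m (h ∘ Fin.suc)))

module _ {c ℓ} (L : FiniteDistributiveLattice c ℓ) where
  open FiniteDistributiveLattice L
  open Inverse enumeration using (to; from; strictlyInverseˡ; strictlyInverseʳ)

  -- Finiteness of the carrier allows one threshold for all elements, namely a maximum.
  eventually-∀ : ∀ {p} {P : Carrier → ℕ → Set p} →
    (∀ x → Eventually (P x)) → Eventually (λ n → ∀ x → P x n)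
  eventually-∀ {P = P} h = eventually-map (λ n hₙ x → subst (λ y → P y n) (strictlyInverseʳ x) (hₙ (to x)))
    (eventually-Fin size (h ∘ from))

  ∈-elements : ∀ x → x ∈ elements
  ∈-elements x = subst (_∈ elements) (strictlyInverseʳ x) (∈-tabulate⁺ (to x))

  elements-unique : Unique elements
  elements-unique = Unique.tabulate⁺ λ {i} {j} e →
    trans (sym (strictlyInverseˡ i)) (trans (cong to e) (strictlyInverseˡ j))

eventually-≥-neg : ∀ x → 0ℝ ≤ℝ x → ∀ {η} → 0ℚ < η → Eventually (λ n → - η ≤ seq x n)
eventually-≥-neg x 0≤x {η} 0<η = eventually-map
  (λ n 0≤xₙ+η → ≤-by-difference (solve 2 (λ x η → x := :- η :+ (x :+ η)) refl (seq x n) η) 0≤xₙ+η)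
  (0≤x η 0<η)

p≤∣p∣ : ∀ p → p ≤ ∣ p ∣
p≤∣p∣ p with ℚ.≤-total 0ℚ p
... | inj₁ 0≤p = ℚ.≤-reflexive (sym (ℚ.0≤p⇒∣p∣≡p 0≤p))
... | inj₂ p≤0 = ℚ.≤-trans p≤0 (ℚ.0≤∣p∣ p)

eventually-bounded : ∀ x → Σ[ B ∈ ℚ ] Eventually (λ n → seq x n ≤ B)
eventually-bounded x =
  let B , _ , bounded = CauchyLemmas.bound {seq x} (cauchy x)
  in B , eventually-map (λ n → ℚ.≤-trans (p≤∣p∣ (seq x n))) bounded

small-multiplier : ∀ K ε → 0ℚ < ε → Σ[ η ∈ ℚ ] 0ℚ < η × η ≤ 1ℚ × η * K ≤ ε
small-multiplier K ε 0<ε =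
  let η , 0<η , ηK′≡ε = CauchyLemmas.divide K′ ε 0<K′ 0<ε
  in truncate η 0<η ηK′≡ε
  where
  -- A positive majorant of `K`, whose sign is arbitrary; division by it is possible.
  K′ = 1ℚ + (K ℚ.⊔ 0ℚ)
  0<K′ : 0ℚ < K′
  0<K′ = ℚ.+-mono-<-≤ (ℚ.positive⁻¹ 1ℚ) (ℚ.p≤q⊔p K 0ℚ)
  K≤K′ : K ≤ K′
  K≤K′ = ℚ.≤-trans (ℚ.p≤p⊔q K 0ℚ) (≤-by-difference (ℚ.+-comm 1ℚ (K ℚ.⊔ 0ℚ)) (ℚ.<⇒≤ (ℚ.positive⁻¹ 1ℚ)))

  truncate : ∀ η → 0ℚ < η → η * K′ ≡ ε → Σ[ η ∈ ℚ ] 0ℚ < η × η ≤ 1ℚ × η * K ≤ ε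
  truncate η 0<η ηK′≡ε = η ℚ.⊓ 1ℚ , 0<η⊓1 , ℚ.p⊓q≤q η 1ℚ , (begin
    (η ℚ.⊓ 1ℚ) * K    ≤⟨ ℚ.*-monoˡ-≤-nonNeg (η ℚ.⊓ 1ℚ) {{nonNegative (ℚ.<⇒≤ 0<η⊓1)}} K≤K′ ⟩
    (η ℚ.⊓ 1ℚ) * K′   ≤⟨ ℚ.*-monoʳ-≤-nonNeg K′ {{nonNegative (ℚ.<⇒≤ 0<K′)}} (ℚ.p⊓q≤p η 1ℚ) ⟩
    η * K′            ≡⟨ ηK′≡ε ⟩
    ε                 ∎)
    where
    open ℚ.≤-Reasoning
    0<η⊓1 : 0ℚ < η ℚ.⊓ 1ℚ
    0<η⊓1 with ℚ.⊓-sel η 1ℚ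
    ... | inj₁ e = subst (0ℚ <_) (sym e) 0<η
    ... | inj₂ e = subst (0ℚ <_) (sym e) (ℚ.positive⁻¹ 1ℚ)

≤+⇒0≤-+ : ∀ {p s ε} → p ≤ s + ε → 0ℚ ≤ s - p + ε
≤+⇒0≤-+ {p} {s} {ε} p≤s+ε = subst (0ℚ ≤_)
  (solve 3 (λ s ε p → s :+ ε :- p := s :- p :+ ε) refl s ε p) (difference-nonNeg p≤s+ε)

-- The coefficientwise inequality for real-valued functions.

theorem1p5 : ∀ {c ℓ p p′ : Level} (L : FiniteDistributiveLattice c ℓ) →
    let open FiniteDistributiveLattice L in
    (r : Carrier → ℕ) → IsRankFunction r →
    (α β γ δ : Carrier → ℝ) →
    (∀ x → 0ℝ ≤ℝ α x) → (∀ x → 0ℝ ≤ℝ β x) →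
    (∀ x → 0ℝ ≤ℝ γ x) → (∀ x → 0ℝ ≤ℝ δ x) →
    (∀ x y → α x *ℝ β y ≤ℝ γ (x ∨ y) *ℝ δ (x ∧ y)) →
    (X : Pred Carrier p) (X? : Decidable X) →
    (Y : Pred Carrier p′) (Y? : Decidable Y) →
    Σₚ X? (λ x → α x ·q^ r x) *ₚ Σₚ Y? (λ x → β x ·q^ r x)
    ≪ Σₚ (X? ∨ˢ? Y?) (λ x → γ x ·q^ r x) *ₚ Σₚ (X? ∧ˢ? Y?) (λ x → δ x ·q^ r x)
theorem1p5 L r rank α β γ δ 0≤α 0≤β 0≤γ 0≤δ h X X? Y Y? k ε 0<ε =
  eventually-map conclude
    (eventually-× (eventually-× (nonNegative-up-to-η α 0≤α) (nonNegative-up-to-η β 0≤β))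
    (eventually-× (eventually-× (nonNegative-up-to-η γ 0≤γ) (nonNegative-up-to-η δ 0≤δ))
    (eventually-× (eventually-× (eventually-∀ L (λ x → proj₂ (eventually-bounded (γ x))))
                                (eventually-∀ L (λ x → proj₂ (eventually-bounded (δ x)))))
      -- The slack `η * η` is the error that `approximate-four-functions` tolerates in the
      -- hypothesis.
      (eventually-∀ L (λ x → eventually-∀ L (λ y → h x y (η * η) (CauchyLemmas.*-pos 0<η 0<η)))))))
  where
  open FiniteDistributiveLattice L
  xs = filter X? elements
  ys = filter Y? elements
  zs = filter (X? ∨ˢ? Y?) elements
  ws = filter (X? ∧ˢ? Y?) elements

  xs! : Unique xs
  xs! = Unique.filter⁺ X? (elements-unique L)
  ys! : Unique ys
  ys! = Unique.filter⁺ Y? (elements-unique L)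

  joins : ∀ {x y} → x ∈ xs → y ∈ ys → (x ∨ y) ∈ zs
  joins {x} {y} x∈xs y∈ys = ∈-filter⁺ (X? ∨ˢ? Y?) (∈-elements L (x ∨ y))
    (x , y , proj₂ (∈-filter⁻ X? {xs = elements} x∈xs) , proj₂ (∈-filter⁻ Y? {xs = elements} y∈ys) , refl)
  meets : ∀ {x y} → x ∈ xs → y ∈ ys → (x ∧ y) ∈ ws
  meets {x} {y} x∈xs y∈ys = ∈-filter⁺ (X? ∧ˢ? Y?) (∈-elements L (x ∧ y))
    (x , y , proj₂ (∈-filter⁻ X? {xs = elements} x∈xs) , proj₂ (∈-filter⁻ Y? {xs = elements} y∈ys) , refl)

  -- The indicator of total rank `k`, selecting the coefficient of `q^k`.
  g : ℕ → ℚ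
  g j = monomial 1ℚ j k
  0≤g : ∀ j → 0ℚ ≤ g j
  0≤g j = monomial-nonNeg j k

  C D : Carrier → ℚ
  C x = proj₁ (eventually-bounded (γ x))
  D x = proj₁ (eventually-bounded (δ x))

  -- The eventual bounds `C`, `D` stand in for `γ`, `δ`, so `K` is independent of the index `n`, and
  -- `η` can be fixed before any threshold.
  K = defect g r xs ys zs ws C D
  multiplier = small-multiplier K ε 0<ε
  η = proj₁ multiplier
  0<η : 0ℚ < η
  0<η = proj₁ (proj₂ multiplier)
  η≤1 : η ≤ 1ℚ
  η≤1 = proj₁ (proj₂ (proj₂ multiplier))
  ηK≤ε : η * K ≤ ε
  ηK≤ε = proj₂ (proj₂ (proj₂ multiplier))

  nonNegative-up-to-η : ∀ (φ : Carrier → ℝ) → (∀ x → 0ℝ ≤ℝ φ x) → Eventually (λ n → ∀ x → - η ≤ seq (φ x) n)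
  nonNegative-up-to-η φ 0≤φ = eventually-∀ L (λ x → eventually-≥-neg (φ x) (0≤φ x) 0<η)

  P = Σₚ X? (λ x → α x ·q^ r x) *ₚ Σₚ Y? (λ x → β x ·q^ r x)
  R = Σₚ (X? ∨ˢ? Y?) (λ x → γ x ·q^ r x) *ₚ Σₚ (X? ∧ˢ? Y?) (λ x → δ x ·q^ r x)

  Approximates : ℕ → Set _
  Approximates n =
    ((∀ x → - η ≤ seq (α x) n) × (∀ x → - η ≤ seq (β x) n)) ×
    ((∀ x → - η ≤ seq (γ x) n) × (∀ x → - η ≤ seq (δ x) n)) ×
    ((∀ x → seq (γ x) n ≤ C x) × (∀ x → seq (δ x) n ≤ D x)) ×
    (∀ x y → seq (α x) n * seq (β y) n ≤ seq (γ (x ∨ y)) n * seq (δ (x ∧ y)) n + η * η)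

  conclude : ∀ n → Approximates n → 0ℚ ≤ approximant n (R -ₚ P) k + ε
  conclude n ((-η≤α , -η≤β) , (-η≤γ , -η≤δ) , (γ≤C , δ≤D) , hₙ) =
    subst (λ t → 0ℚ ≤ t + ε) (sym (approximant-- n R P k)) (≤+⇒0≤-+ {approximant n P k} {approximant n R k} P≤R+ε)
    where
    open ℚ.≤-Reasoning
    P≤R+ε : approximant n P k ≤ approximant n R k + ε
    P≤R+ε = begin
      approximant n P k
        ≡⟨ approximant-product n xs ys α β r k ⟩
      graded-sum g r xs ys (λ x y → seq (α x) n * seq (β y) n)
        ≤⟨ approximate-four-functions L (cubeEmbedding L rank) 0≤g xs! ys! joins meets (ℚ.<⇒≤ 0<η) η≤1
             -η≤α -η≤β -η≤γ -η≤δ γ≤C δ≤D hₙ ⟩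
      graded-sum g r zs ws (λ x y → seq (γ x) n * seq (δ y) n) + η * K
        ≤⟨ ℚ.+-monoʳ-≤ (graded-sum g r zs ws (λ x y → seq (γ x) n * seq (δ y) n)) ηK≤ε ⟩
      graded-sum g r zs ws (λ x y → seq (γ x) n * seq (δ y) n) + ε
        ≡⟨ cong (_+ ε) (approximant-product n zs ws γ δ r k) ⟨
      approximant n R k + ε ∎
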